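{- For any integers $r,t\ge1$, any real $a\in(3/2,2]$ and any $\gamma>0$, there exists $n_0$ such that for all $n\ge n_0$, every digraph $G$ on $n$ vertices with $e_a(G)\ge a\,t_r(n)+\gamma n^2$ contains $T_{r+1}^t$ as a subdigraph.
   Context: A digraph is a set of vertices with a set of ordered pairs of distinct vertices (arcs). For a digraph $G$, $f_1(G)$ is the number of unordered pairs $\{u,v\}$ such that exactly one of $uv,vu$ is an arc, and $f_2(G)$ is the number of unordered pairs with both $uv$ and $vu$ arcs; for real $a\ge1$, $e_a(G)=a f_2(G)+f_1(G)$. $t_r(n)$ is the number of edges of the $r$-partite Turán graph on $n$ vertices (complete $r$-partite graph with parts as equal as possible). $T_{r+1}$ is the transitive tournament on $r+1$ vertices, and $T_{r+1}^t$ is obtained from $T_{r+1}$ by replacing each vertex by an independent set of size $t$ and adding all arcs from the $i$-th set to the $j$-th set whenever $ij$ is an arc of $T_{r+1}$.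
   Formalization: The parameters a in (3/2,2] and γ > 0 are taken to be rational numbers rather than real numbers. -}

module Defs where

open import Data.Nat using (ℕ; zero; suc; _+_; _*_; _<_; _<ᵇ_; _≡ᵇ_; NonZero)
open import Data.Nat.DivMod using (_%_)
open import Data.Bool using (Bool; true; false; _∧_; _∨_; not; if_then_else_)
open import Data.Fin using (Fin; toℕ)
import Data.Fin as Fin
open import Data.Product using (_×_; _,_; Σ)
open import Function.Definitions using (Injective)
open import Relation.Binary.PropositionalEquality using (_≡_)
open import Data.Integer using (+_)
open import Data.Rational using (ℚ; _/_)
import Data.Rational as ℚ

record Digraph (n : ℕ) : Set where
  field
    adj   : Fin n → Fin n → Bool
    irrefl : ∀ v → adj v v ≡ false
open Digraph public

sumFin : (n : ℕ) → (Fin n → ℕ) → ℕ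
sumFin zero    f = 0
sumFin (suc n) f = f Fin.zero + sumFin n (λ i → f (Fin.suc i))

countPairs : (n : ℕ) → (Fin n → Fin n → Bool) → ℕ
countPairs n P = sumFin n (λ u → sumFin n (λ v →
  if (toℕ u <ᵇ toℕ v) ∧ P u v then 1 else 0))

xor : Bool → Bool → Bool
xor true  b = not b
xor false b = b

f₁ : ∀ {n} → Digraph n → ℕ
f₁ {n} G = countPairs n (λ u v → xor (adj G u v) (adj G v u))

f₂ : ∀ {n} → Digraph n → ℕ
f₂ {n} G = countPairs n (λ u v → adj G u v ∧ adj G v u)

ℕ→ℚ : ℕ → ℚ
ℕ→ℚ m = (+ m) / 1

e : ℚ → ∀ {n} → Digraph n → ℚ
e a G = a ℚ.* ℕ→ℚ (f₂ G) ℚ.+ ℕ→ℚ (f₁ G)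

-- t_r(n): edges of the r-partite Turán graph on n vertices. Vertex v lies in part
-- (v mod r); the parts then have sizes ⌊n/r⌋ or ⌈n/r⌉ (as equal as possible),
-- and edges join vertices in different parts.
turan : (r : ℕ) → .{{_ : NonZero r}} → ℕ → ℕ
turan r n = countPairs n (λ u v → not ((toℕ u % r) ≡ᵇ (toℕ v % r)))

-- T_{r+1}^t: vertices (i , x) with i : Fin (r+1), x : Fin t; arc (i,x) → (j,y) iff i < j
-- (the transitive tournament on Fin (r+1) ordered by <, blown up).
blowArc : ∀ {r t} → (Fin (suc r) × Fin t) → (Fin (suc r) × Fin t) → Set
blowArc (i , _) (j , _) = toℕ i < toℕ j

ContainsBlowup : ∀ {n} → Digraph n → (r t : ℕ) → Set
ContainsBlowup {n} G r t =
  Σ (Fin (suc r) × Fin t → Fin n) λ φ →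
    Injective _≡_ _≡_ φ ×
    (∀ p q → blowArc {r} {t} p q → adj G (φ p) (φ q) ≡ true)

{-# OPTIONS --safe #-}

-- Dividing by a, one may assume a = 3 / 2. Order the vertices of a digraph on M vertices uniformly at
-- random and keep v if all earlier vertices dominate v or v dominates all earlier vertices. The kept
-- vertices span a transitive tournament, and v is kept with probability
-- 1/α + 1/β − 1/μ ≥ 3 / (2α + 2β − μ), where α, β, μ are the numbers of vertices (v included) that are
-- not in-neighbours, not out-neighbours, not both. By Cauchy–Schwarz some transitive tournament has at
-- least 3 M² / C vertices, where C is the sum of 2α + 2β − μ. A random M-tuple of vertices of G (M a
-- large constant) therefore contains T_{r+1} with positive probability, hence some fixed positions
-- carry T_{r+1} in a positive proportion of all M-tuples. By the M-partite Kővári–Sós–Turán argument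
-- there are t-sets X₁, …, X_M such that all tuples in X₁ × … × X_M have this property, and the sets at
-- those positions form the blow-up.
module Submission where

open import Defs
open import Data.Nat using (ℕ; zero; suc; NonZero; _^_; z≤n; s≤s; _≡ᵇ_; _<ᵇ_; _!; _+_; _*_; _≤_; _<_;
  _≤?_; _<?_; _∸_; _⊔_; >-nonZero; >-nonZero⁻¹)
open import Data.Nat.Properties hiding (_≟_)
open import Data.Nat.Divisibility using (∣-trans; m∣m*n; m≤n⇒m!∣n!)
open import Data.Nat.DivMod using (_/_; _%_; m*[n/m]≡n; m≡m%n+[m/n]*n; m%n<n)
open import Data.Nat.Tactic.RingSolver using (solve-∀)
open import Data.Bool using (Bool; true; false; _∧_; _∨_; not; if_then_else_) renaming (T to IsTrue)
open import Data.Bool.Properties using (∧-comm)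
open import Data.Fin using (Fin; toℕ)
import Data.Fin as Fin
open import Data.Fin.Properties using (_≟_; toℕ-injective)
open import Data.List using (List; []; _∷_; _++_; length; allFin; cartesianProductWith)
import Data.List as List
open import Data.List.Properties using (length-++; length-tabulate)
open import Data.List.Relation.Unary.All using (All; []; _∷_)
import Data.List.Relation.Unary.All as All
import Data.List.Relation.Unary.All.Properties as All
open import Data.List.Relation.Unary.AllPairs using (AllPairs; []; _∷_)
import Data.List.Relation.Unary.AllPairs.Properties as AllPairs
open import Data.Vec using (Vec; []; _∷_; lookup; tabulate)
open import Data.Vec.Properties using (lookup∘tabulate)
open import Data.Product using (∃; _×_; _,_; proj₁; proj₂)
open import Data.Sum using (_⊎_; inj₁; inj₂)
open import Data.Unit using (tt)
open import Function using (_∘_; id)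
open import Function.Definitions using (Injective)
open import Relation.Nullary using (yes; no; ⌊_⌋; contradiction)
open import Relation.Binary.Definitions using (tri<; tri≈; tri>)
open import Relation.Binary.PropositionalEquality
  using (_≡_; _≢_; refl; sym; trans; cong; cong₂; subst; subst₂; module ≡-Reasoning)
import Data.Integer as ℤ
import Data.Integer.Properties as ℤ
import Data.Rational as ℚ
import Data.Rational.Properties as ℚ
import Data.Rational.Unnormalised as ℚᵘ
import Data.Rational.Unnormalised.Properties as ℚᵘ
open import Data.Rational using (ℚ; mkℚ)

-- The value 3/2 is set by the probability bound. Give a non-neighbour cost 3 and a one-way
-- neighbour cost κ. If `p` one-way neighbours point each way and `p` is large against the number
-- `ν` of non-neighbours, then 1/α + 1/β - 1/μ is asymptotic to 3/(2p), so 3/(3ν + 2κp) can be a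
-- lower bound only if κ ≥ 1. Costs 0, 1, 3 correspond to weights 3, 2, 0, and 3 : 2 is the ratio of
-- a double edge to a single one. No probability space of orders is built. The numbers `D` / j obey
-- the recursion given by conditioning on the last vertex, and following a last vertex for which the
-- conditional expectation does not fall yields the tournament by induction on the vertex set. The
-- vertices kept for both reasons enter with a minus sign, so their term stays on the opposite side
-- of every inequality in ℕ. Tuples are drawn with repetition, so that sums over them factor by
-- coordinates. A repeated vertex is just a non-adjacent pair of positions of cost 3, and the
-- diagonal costs only order `M` against `M * M`.

private variable
  A B : Set
  n k : ℕ

-- Finite sums

∑ : List A → (A → ℕ) → ℕ
∑ []       f = 0
∑ (x ∷ xs) f = f x + ∑ xs f

infix 5 ∑
syntax ∑ xs (λ x → e) = ∑[ x ∈ xs ] e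

∑-cong : ∀ (xs : List A) {f g} → (∀ x → f x ≡ g x) → ∑ xs f ≡ ∑ xs g
∑-cong []       eq = refl
∑-cong (x ∷ xs) eq = cong₂ _+_ (eq x) (∑-cong xs eq)

∑-mono : ∀ (xs : List A) {f g} → (∀ x → f x ≤ g x) → ∑ xs f ≤ ∑ xs g
∑-mono []       le = z≤n
∑-mono (x ∷ xs) le = +-mono-≤ (le x) (∑-mono xs le)

∑-+ : ∀ (xs : List A) f g → ∑ xs (λ x → f x + g x) ≡ ∑ xs f + ∑ xs g
∑-+ []       f g = refl
∑-+ (x ∷ xs) f g = trans (cong (f x + g x +_) (∑-+ xs f g)) (eq (f x) (g x) (∑ xs f) (∑ xs g))
  where
  eq : ∀ a b c d → a + b + (c + d) ≡ a + c + (b + d)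
  eq = solve-∀

∑-*ˡ : ∀ (xs : List A) c f → ∑ xs (λ x → c * f x) ≡ c * ∑ xs f
∑-*ˡ []       c f = sym (*-zeroʳ c)
∑-*ˡ (x ∷ xs) c f = trans (cong (c * f x +_) (∑-*ˡ xs c f)) (sym (*-distribˡ-+ c (f x) (∑ xs f)))

∑-*ʳ : ∀ (xs : List A) c f → ∑ xs (λ x → f x * c) ≡ ∑ xs f * c
∑-*ʳ []       c f = refl
∑-*ʳ (x ∷ xs) c f = trans (cong (f x * c +_) (∑-*ʳ xs c f)) (sym (*-distribʳ-+ c (f x) (∑ xs f)))

∑-const : ∀ (xs : List A) c → ∑ xs (λ _ → c) ≡ length xs * c
∑-const []       c = refl
∑-const (x ∷ xs) c = cong (c +_) (∑-const xs c)

∑-swap : ∀ (xs : List A) (ys : List B) (f : A → B → ℕ) →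
  ∑ xs (λ x → ∑ ys (f x)) ≡ ∑ ys (λ y → ∑ xs (λ x → f x y))
∑-swap []       ys f = sym (trans (∑-const ys 0) (*-zeroʳ (length ys)))
∑-swap (x ∷ xs) ys f =
  trans (cong (∑ ys (f x) +_) (∑-swap xs ys f)) (sym (∑-+ ys (f x) (λ y → ∑ xs (λ x → f x y))))

∑-++ : ∀ (xs ys : List A) f → ∑ (xs ++ ys) f ≡ ∑ xs f + ∑ ys f
∑-++ []       ys f = refl
∑-++ (x ∷ xs) ys f = trans (cong (f x +_) (∑-++ xs ys f)) (sym (+-assoc (f x) _ _))

∑-map : ∀ (xs : List A) (g : A → B) f → ∑ (List.map g xs) f ≡ ∑ xs (f ∘ g)
∑-map []       g f = refl
∑-map (x ∷ xs) g f = cong (f (g x) +_) (∑-map xs g f)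

∑-tabulate : ∀ n (g : Fin n → A) f → ∑ (List.tabulate g) f ≡ sumFin n (f ∘ g)
∑-tabulate zero    g f = refl
∑-tabulate (suc n) g f = cong (f (g Fin.zero) +_) (∑-tabulate n (g ∘ Fin.suc) f)

∑-allFin : ∀ n f → ∑ (allFin n) f ≡ sumFin n f
∑-allFin n = ∑-tabulate n id

∑-pigeonhole-< : ∀ (xs : List A) f g → ∑ xs f < ∑ xs g → ∃ λ x → f x < g x
∑-pigeonhole-< (x ∷ xs) f g lt with f x <? g x
... | yes p = x , p
... | no ¬p = ∑-pigeonhole-< xs f g
  (+-cancelˡ-< (f x) _ _ (≤-trans lt (+-monoˡ-≤ (∑ xs g) (≮⇒≥ ¬p))))

∑-pigeonhole-≤ : ∀ (xs : List A) f g → 0 < length xs → ∑ xs f ≤ ∑ xs g → ∃ λ x → f x ≤ g x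
∑-pigeonhole-≤ xs f g 0<n le with ∑-pigeonhole-< xs f (λ x → 1 + g x) lt
  where
  lt : ∑ xs f < ∑ xs (λ x → 1 + g x)
  lt = ≤-trans (+-mono-≤ 0<n le)
    (≤-reflexive (sym (trans (∑-+ xs (λ _ → 1) g)
      (cong (_+ ∑ xs g) (trans (∑-const xs 1) (*-identityʳ _))))))
... | x , s≤s p = x , p

ind : Bool → ℕ
ind b = if b then 1 else 0

ind≤1 : ∀ b → ind b ≤ 1
ind≤1 true  = ≤-refl
ind≤1 false = z≤n

0<ind : ∀ b → 0 < ind b → b ≡ true
0<ind true _ = refl

ind+ind-not : ∀ b → ind b + ind (not b) ≡ 1
ind+ind-not true  = refl
ind+ind-not false = refl

sumFin-cong : ∀ n {f g} → (∀ x → f x ≡ g x) → sumFin n f ≡ sumFin n g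
sumFin-cong zero    eq = refl
sumFin-cong (suc n) eq = cong₂ _+_ (eq Fin.zero) (sumFin-cong n (eq ∘ Fin.suc))

sumFin-0 : ∀ n → sumFin n (λ _ → 0) ≡ 0
sumFin-0 zero    = refl
sumFin-0 (suc n) = sumFin-0 n

sumFin-≟ : ∀ n w (f : Fin n → ℕ) → sumFin n (λ u → ind ⌊ u ≟ w ⌋ * f u) ≡ f w
sumFin-≟ (suc n) Fin.zero f =
  trans (cong₂ _+_ (*-identityˡ (f Fin.zero)) (sumFin-0 n)) (+-identityʳ _)
sumFin-≟ (suc n) (Fin.suc w) f =
  trans (sumFin-cong n λ u → cong (λ b → ind b * f (Fin.suc u)) (same u))
        (sumFin-≟ n w (f ∘ Fin.suc))
  where
  same : ∀ u → ⌊ Fin.suc u ≟ Fin.suc w ⌋ ≡ ⌊ u ≟ w ⌋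
  same u with u ≟ w
  ... | yes _ = refl
  ... | no  _ = refl

∑-≟ : ∀ n w (f : Fin n → ℕ) → ∑ (allFin n) (λ u → ind ⌊ u ≟ w ⌋ * f u) ≡ f w
∑-≟ n w f = trans (∑-allFin n _) (sumFin-≟ n w f)

-- Transitive tournaments in weighted digraphs

_∖_ : ∀ {n} → (Fin n → Bool) → Fin n → Fin n → Bool
(S ∖ w) u = S u ∧ not ⌊ u ≟ w ⌋

cnt : ∀ {n} → (Fin n → Bool) → (Fin n → Bool) → ℕ
cnt {n} S P = ∑[ u ∈ allFin n ] ind (S u) * ind (P u)

size : ∀ {n} → (Fin n → Bool) → ℕ
size {n} S = ∑[ u ∈ allFin n ] ind (S u)

∑-∖ : ∀ {n} S w (f : Fin n → ℕ) →
  ∑ (allFin n) (λ u → ind (S u) * f u) ≡ ind (S w) * f w + ∑ (allFin n) (λ u → ind ((S ∖ w) u) * f u)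
∑-∖ {n} S w f = begin
  ∑ (allFin n) (λ u → ind (S u) * f u)
    ≡⟨ ∑-cong (allFin n) split ⟩
  ∑ (allFin n) (λ u → ind ⌊ u ≟ w ⌋ * (ind (S u) * f u) + ind ((S ∖ w) u) * f u)
    ≡⟨ ∑-+ (allFin n) _ _ ⟩
  ∑ (allFin n) (λ u → ind ⌊ u ≟ w ⌋ * (ind (S u) * f u)) + ∑ (allFin n) (λ u → ind ((S ∖ w) u) * f u)
    ≡⟨ cong (_+ ∑ (allFin n) (λ u → ind ((S ∖ w) u) * f u)) (∑-≟ n w _) ⟩
  ind (S w) * f w + ∑ (allFin n) (λ u → ind ((S ∖ w) u) * f u) ∎
  where
  open ≡-Reasoning
  split : ∀ u → ind (S u) * f u ≡ ind ⌊ u ≟ w ⌋ * (ind (S u) * f u) + ind ((S ∖ w) u) * f u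
  split u with S u | ⌊ u ≟ w ⌋
  ... | true  | true  = sym (trans (+-identityʳ _) (+-identityʳ _))
  ... | true  | false = refl
  ... | false | true  = refl
  ... | false | false = refl

∈∖⇒∈ : ∀ {n} S (v w : Fin n) → (S ∖ w) v ≡ true → S v ≡ true
∈∖⇒∈ S v w eq with S v
... | true = refl

-- h j stands for D / j, where D is a common multiple of 1, …, M; its value at 0 is junk.
module Reciprocal (M D : ℕ) (h : ℕ → ℕ) (h-spec : ∀ j → j < M → suc j * h (suc j) ≡ D) where

  V : List (Fin M)
  V = allFin M

  size≤M : ∀ (S : Fin M → Bool) → size S ≤ M
  size≤M S = ≤-trans (∑-mono V (λ u → ind≤1 (S u)))
    (≤-reflexive (trans (∑-const V 1) (trans (*-identityʳ _) (length-tabulate id))))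

  cnt-≤ : ∀ (S P : Fin M → Bool) → cnt S P ≤ size S
  cnt-≤ S P = ∑-mono V λ u → ≤-trans (*-monoʳ-≤ (ind (S u)) (ind≤1 (P u))) (≤-reflexive (*-identityʳ _))

  cnt-∖ : ∀ (S P : Fin M → Bool) w → cnt S P ≡ ind (S w) * ind (P w) + cnt (S ∖ w) P
  cnt-∖ S P w = ∑-∖ S w (ind ∘ P)

  size-∖ : ∀ (S : Fin M → Bool) w → S w ≡ true → size S ≡ suc (size (S ∖ w))
  size-∖ S w Sw = begin
    size S                                      ≡⟨ ∑-cong V (λ u → sym (*-identityʳ _)) ⟩
    ∑ V (λ u → ind (S u) * 1)                   ≡⟨ ∑-∖ S w (λ _ → 1) ⟩
    ind (S w) * 1 + ∑ V (λ u → ind ((S ∖ w) u) * 1)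
      ≡⟨ cong₂ _+_ (cong (λ b → ind b * 1) Sw) (∑-cong V (λ u → *-identityʳ _)) ⟩
    suc (size (S ∖ w))                          ∎
    where open ≡-Reasoning

  cnt-split : ∀ (S P : Fin M → Bool) → cnt S P + cnt S (not ∘ P) ≡ size S
  cnt-split S P = trans (sym (∑-+ V _ _)) (∑-cong V λ u →
    trans (sym (*-distribˡ-+ (ind (S u)) _ _)) (trans (cong (ind (S u) *_) (ind+ind-not (P u))) (*-identityʳ _)))

  -- In a uniformly random order of S, the probability that v comes first in P is 1 / cnt S P;
  -- this is the law of total probability over the last element w.
  deletion-average : ∀ (S P : Fin M → Bool) v → S v ≡ true → P v ≡ true →
    ∑ V (λ w → ind (S w) * (ind ((S ∖ w) v) * h (cnt (S ∖ w) P))) + ind (cnt S P ≡ᵇ 1) * D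
      ≡ size S * h (cnt S P)
  deletion-average S P v Sv Pv = begin
    ∑ V (λ w → ind (S w) * (ind ((S ∖ w) v) * h (cnt (S ∖ w) P))) + ind (cnt S P ≡ᵇ 1) * D
      ≡⟨ cong₂ (λ x y → x + ind (y ≡ᵇ 1) * D) (∑-cong V term) cnt≡ ⟩
    -- A last vertex `w` other than `v` either lies in `P`, which leaves `c` candidates including
    -- `v`, or lies outside, which leaves `suc c`. There are `c` and `d` such `w`.
    ∑ V (λ w → ind (S' w) * ind (P w) * h c + ind (S' w) * ind (not (P w)) * h (suc c)) + ind (c ≡ᵇ 0) * D
      ≡⟨ cong (_+ ind (c ≡ᵇ 0) * D) (trans (∑-+ V _ _) (cong₂ _+_ (∑-*ʳ V _ _) (∑-*ʳ V _ _))) ⟩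
    c * h c + d * h (suc c) + ind (c ≡ᵇ 0) * D
      ≡⟨ swap₂ (c * h c) (d * h (suc c)) (ind (c ≡ᵇ 0) * D) ⟩
    c * h c + ind (c ≡ᵇ 0) * D + d * h (suc c)
      ≡⟨ cong (_+ d * h (suc c)) (zero-or-spec c (≤-trans (n≤1+n c) c<M)) ⟩
    D + d * h (suc c)
      ≡⟨ cong (_+ d * h (suc c)) (sym (h-spec c c<M)) ⟩
    suc c * h (suc c) + d * h (suc c)
      ≡⟨ *-distribʳ-+ (h (suc c)) (suc c) d ⟨
    (suc c + d) * h (suc c)
      ≡⟨ cong₂ (λ x y → x * h y) (sym (trans (size-∖ S v Sv) (cong suc (sym (cnt-split S' P))))) (sym cnt≡) ⟩
    size S * h (cnt S P) ∎
    where
    open ≡-Reasoning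
    S' : Fin M → Bool
    S' = S ∖ v
    c d : ℕ
    c = cnt S' P
    d = cnt S' (not ∘ P)
    cnt≡ : cnt S P ≡ suc c
    cnt≡ = trans (cnt-∖ S P v) (cong₂ (λ a b → ind a * ind b + c) Sv Pv)
    c<M : c < M
    c<M = ≤-trans (≤-reflexive (sym cnt≡)) (≤-trans (cnt-≤ S P) (size≤M S))
    swap₂ : ∀ x y z → x + y + z ≡ x + z + y
    swap₂ = solve-∀
    -- For `c` zero the product kills the junk value `h 0`, and the indicator supplies `D`: a `v`
    -- alone in `P` is first even when it comes last in `S`.
    zero-or-spec : ∀ c → c ≤ M → c * h c + ind (c ≡ᵇ 0) * D ≡ D
    zero-or-spec zero    _ = +-identityʳ D
    zero-or-spec (suc c) p = trans (+-identityʳ _) (h-spec c p)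
    cnt-w : ∀ w → S w ≡ true → ind (P w) + cnt (S ∖ w) P ≡ suc c
    cnt-w w Sw = trans (cong (_+ cnt (S ∖ w) P) (sym (trans (cong (λ b → ind b * ind (P w)) Sw) (+-identityʳ _))))
      (trans (sym (cnt-∖ S P w)) cnt≡)
    term : ∀ w → ind (S w) * (ind ((S ∖ w) v) * h (cnt (S ∖ w) P))
      ≡ ind (S' w) * ind (P w) * h c + ind (S' w) * ind (not (P w)) * h (suc c)
    term w rewrite Sv with v ≟ w | w ≟ v | S w in Sw
    ... | yes refl | yes _    | false = refl
    ... | yes refl | yes _    | true  = refl
    ... | yes refl | no w≢v   | _     = contradiction refl w≢v
    ... | no v≢w   | yes refl | _     = contradiction refl v≢w
    ... | no _     | no _     | false = refl
    ... | no _     | no _     | true  with P w | cnt-w w Sw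
    ...   | true  | eq = cong (λ x → h x + 0 + 0) (suc-injective eq)
    ...   | false | eq = trans (+-identityʳ _) (cong (λ x → h x + 0) eq)

  -- When `P v v` holds for every `v`, this is `D` times the expected number of `v` in `S` that
  -- precede all other members of `P v` in a random order of `S`.
  Φ : (Fin M → Fin M → Bool) → (Fin M → Bool) → ℕ
  Φ P S = ∑[ v ∈ V ] ind (S v) * h (cnt S (P v))

  -- Sum `deletion-average` over `v` and exchange the sums. The case in which `v` itself comes last
  -- is booked under `w`, so the bracket is `D` times the conditional expectation given that `w` is
  -- last.
  Φ-average : ∀ P → (∀ v → P v v ≡ true) → ∀ S →
    ∑ V (λ w → ind (S w) * (Φ P (S ∖ w) + ind (cnt S (P w) ≡ᵇ 1) * D)) ≡ size S * Φ P S
  Φ-average P P-refl S = begin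
    ∑ V (λ w → ind (S w) * (Φ P (S ∖ w) + ind (cnt S (P w) ≡ᵇ 1) * D))
      ≡⟨ ∑-cong V (λ w → *-distribˡ-+ (ind (S w)) _ _) ⟩
    ∑ V (λ w → ind (S w) * Φ P (S ∖ w) + ind (S w) * (ind (cnt S (P w) ≡ᵇ 1) * D))
      ≡⟨ ∑-+ V _ _ ⟩
    ∑ V (λ w → ind (S w) * Φ P (S ∖ w)) + ∑ V (λ w → ind (S w) * (ind (cnt S (P w) ≡ᵇ 1) * D))
      ≡⟨ cong (_+ ∑ V (λ w → ind (S w) * (ind (cnt S (P w) ≡ᵇ 1) * D)))
           (trans (∑-cong V (λ w → sym (∑-*ˡ V (ind (S w)) _))) (∑-swap V V _)) ⟩
    ∑ V (λ v → ∑ V (λ w → ind (S w) * (ind ((S ∖ w) v) * h (cnt (S ∖ w) (P v)))))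
      + ∑ V (λ w → ind (S w) * (ind (cnt S (P w) ≡ᵇ 1) * D))
      ≡⟨ ∑-+ V _ _ ⟨
    ∑ V (λ v → ∑ V (λ w → ind (S w) * (ind ((S ∖ w) v) * h (cnt (S ∖ w) (P v))))
               + ind (S v) * (ind (cnt S (P v) ≡ᵇ 1) * D))
      ≡⟨ ∑-cong V pointwise ⟩
    ∑ V (λ v → size S * (ind (S v) * h (cnt S (P v))))
      ≡⟨ ∑-*ˡ V (size S) _ ⟩
    size S * Φ P S ∎
    where
    open ≡-Reasoning
    pointwise : ∀ v →
      ∑ V (λ w → ind (S w) * (ind ((S ∖ w) v) * h (cnt (S ∖ w) (P v)))) + ind (S v) * (ind (cnt S (P v) ≡ᵇ 1) * D)
        ≡ size S * (ind (S v) * h (cnt S (P v)))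
    pointwise v = go (S v) refl
      where
      go : ∀ b → S v ≡ b →
        ∑ V (λ w → ind (S w) * (ind ((S ∖ w) v) * h (cnt (S ∖ w) (P v)))) + ind (S v) * (ind (cnt S (P v) ≡ᵇ 1) * D)
          ≡ size S * (ind (S v) * h (cnt S (P v)))
      go true Sv = trans
        (cong (∑ V (λ w → ind (S w) * (ind ((S ∖ w) v) * h (cnt (S ∖ w) (P v)))) +_)
          (trans (cong (λ b → ind b * (ind (cnt S (P v) ≡ᵇ 1) * D)) Sv) (+-identityʳ _)))
        (trans (deletion-average S (P v) v Sv (P-refl v))
          (cong (size S *_) (sym (trans (cong (λ b → ind b * h (cnt {M} S (P v))) Sv) (+-identityʳ _)))))
      go false Sv = trans
        (cong₂ _+_ (trans (∑-cong V λ w → trans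
            (cong (λ b → ind (S w) * (ind (b ∧ not ⌊ v ≟ w ⌋) * h (cnt (S ∖ w) (P v)))) Sv) (*-zeroʳ (ind (S w))))
            (trans (∑-const V 0) (*-zeroʳ (length V))))
          (cong (λ b → ind b * (ind (cnt S (P v) ≡ᵇ 1) * D)) Sv))
        (sym (trans (cong (λ b → size S * (ind b * h (cnt S (P v)))) Sv) (*-zeroʳ (size S))))

-- Long transitive tournaments by choosing the last vertex

term≤∑ : ∀ {n} v (f : Fin n → ℕ) → f v ≤ ∑ (allFin n) f
term≤∑ {n} v f = ≤-trans (≤-reflexive (sym (∑-≟ n v f)))
  (∑-mono (allFin n) λ u → ≤-trans (*-monoˡ-≤ (f u) (ind≤1 ⌊ u ≟ v ⌋)) (≤-reflexive (*-identityˡ _)))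

module Chains {M : ℕ} (adj : Fin M → Fin M → Bool) (irr : ∀ v → adj v v ≡ false) where

  ¬in ¬out ¬both : Fin M → Fin M → Bool
  ¬in   v u = not (adj u v)
  ¬out  v u = not (adj v u)
  ¬both v u = not (adj u v ∧ adj v u)

  IsChain : List (Fin M) → Set
  IsChain = AllPairs (λ u v → adj u v ≡ true)

  ¬in-refl : ∀ v → ¬in v v ≡ true
  ¬in-refl v = cong not (irr v)

  ¬both-refl : ∀ v → ¬both v v ≡ true
  ¬both-refl v rewrite irr v = refl

  module _ (D : ℕ) (h : ℕ → ℕ) (h-spec : ∀ j → j < M → suc j * h (suc j) ≡ D) where
    open Reciprocal M D h h-spec

    cnt≡1⇒cnt-∖≡0 : ∀ (S P : Fin M → Bool) w → S w ≡ true → P w ≡ true → (cnt S P ≡ᵇ 1) ≡ true → cnt (S ∖ w) P ≡ 0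
    cnt≡1⇒cnt-∖≡0 S P w Sw Pw eq rewrite cnt-∖ S P w | Sw | Pw with cnt (S ∖ w) P
    ... | zero = refl

    cnt-∖≡0⇒cnt≡1 : ∀ (S P : Fin M → Bool) w → S w ≡ true → P w ≡ true → cnt (S ∖ w) P ≡ 0 → (cnt S P ≡ᵇ 1) ≡ true
    cnt-∖≡0⇒cnt≡1 S P w Sw Pw eq rewrite cnt-∖ S P w | Sw | Pw | eq = refl

    cnt≡0⇒∉ : ∀ (S P : Fin M → Bool) u → cnt S P ≡ 0 → S u ≡ true → P u ≡ false
    cnt≡0⇒∉ S P u eq Su with S u | P u | term≤∑ u (λ u → ind (S u) * ind (P u))
    cnt≡0⇒∉ S P u eq refl | true | false | _ = refl
    cnt≡0⇒∉ S P u eq refl | true | true  | le rewrite eq with () ← le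

    -- `¬both w` is the union of `¬in w` and `¬out w`, so if each of these meets `S` in `w` alone,
    -- so does their union.
    ¬both≡1 : ∀ S w → S w ≡ true → (cnt S (¬in w) ≡ᵇ 1) ≡ true → (cnt S (¬out w) ≡ᵇ 1) ≡ true →
      (cnt S (¬both w) ≡ᵇ 1) ≡ true
    ¬both≡1 S w Sw in≡1 out≡1 = cnt-∖≡0⇒cnt≡1 S (¬both w) w Sw (¬both-refl w) (n≤0⇒n≡0 (begin
      cnt (S ∖ w) (¬both w)
        ≤⟨ ∑-mono V pointwise ⟩
      ∑ V (λ u → ind ((S ∖ w) u) * ind (¬in w u) + ind ((S ∖ w) u) * ind (¬out w u))
        ≡⟨ ∑-+ V _ _ ⟩
      cnt (S ∖ w) (¬in w) + cnt (S ∖ w) (¬out w)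
        ≡⟨ cong₂ _+_ (cnt≡1⇒cnt-∖≡0 S (¬in w) w Sw (¬in-refl w) in≡1)
                     (cnt≡1⇒cnt-∖≡0 S (¬out w) w Sw (¬in-refl w) out≡1) ⟩
      0 ∎))
      where
      open ≤-Reasoning
      pointwise : ∀ u → ind ((S ∖ w) u) * ind (¬both w u)
        ≤ ind ((S ∖ w) u) * ind (¬in w u) + ind ((S ∖ w) u) * ind (¬out w u)
      pointwise u with (S ∖ w) u | adj u w | adj w u
      ... | false | _     | _     = z≤n
      ... | true  | true  | true  = z≤n
      ... | true  | true  | false = s≤s z≤n
      ... | true  | false | _     = s≤s z≤n

    -- With `w` last in the order, `w` is kept if all of `S ∖ w` dominates it (it then goes to the
    -- end of the chain) or if it dominates all of `S ∖ w` (it then goes to the front).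
    extend : ∀ S w → S w ≡ true → ∀ cs → All (λ u → (S ∖ w) u ≡ true) cs → IsChain cs →
      ∃ λ cs⁺ → All (λ u → S u ≡ true) cs⁺ × IsChain cs⁺ ×
        length cs + ind (cnt S (¬in w) ≡ᵇ 1) + ind (cnt S (¬out w) ≡ᵇ 1)
          ≤ length cs⁺ + ind (cnt S (¬both w) ≡ᵇ 1)
    extend S w Sw cs cs⊆ chain with cnt S (¬in w) ≡ᵇ 1 in in≡ | cnt S (¬out w) ≡ᵇ 1 in out≡
    ... | false | false = cs , All.map (∈∖⇒∈ S _ w) cs⊆ , chain ,
      ≤-trans (≤-reflexive (trans (+-identityʳ _) (+-identityʳ _))) (m≤m+n _ _)
    ... | false | true  = w ∷ cs , Sw ∷ All.map (∈∖⇒∈ S _ w) cs⊆ , All.map dominates cs⊆ ∷ chain ,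
      ≤-trans (≤-reflexive (trans (cong (_+ 1) (+-identityʳ _)) (+-comm _ 1))) (m≤m+n _ _)
      where
      dominates : ∀ {u} → (S ∖ w) u ≡ true → adj w u ≡ true
      dominates {u} u∈ with adj w u
        | cnt≡0⇒∉ (S ∖ w) (¬out w) u (cnt≡1⇒cnt-∖≡0 S (¬out w) w Sw (¬in-refl w) out≡) u∈
      ... | true | _ = refl
    -- A vertex kept for both reasons is added only once; the indicator of `¬both` on the right pays
    -- for the second count.
    ... | true  | o = cs ++ w ∷ [] , All.++⁺ (All.map (∈∖⇒∈ S _ w) cs⊆) (Sw ∷ []) ,
      AllPairs.++⁺ chain ([] ∷ []) (All.map (λ u∈ → dominated u∈ ∷ []) cs⊆) ,
      +-mono-≤ (≤-reflexive (sym (length-++ cs))) (both o out≡)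
      where
      dominated : ∀ {u} → (S ∖ w) u ≡ true → adj u w ≡ true
      dominated {u} u∈ with adj u w
        | cnt≡0⇒∉ (S ∖ w) (¬in w) u (cnt≡1⇒cnt-∖≡0 S (¬in w) w Sw (¬in-refl w) in≡) u∈
      ... | true | _ = refl
      both : ∀ o → (cnt S (¬out w) ≡ᵇ 1) ≡ o → ind o ≤ ind (cnt S (¬both w) ≡ᵇ 1)
      both false _  = z≤n
      both true  eq rewrite ¬both≡1 S w Sw in≡ eq = ≤-refl

    -- Method of conditional expectations. Divided by `D`, the difference of the `Φ` terms is the
    -- expected number of kept vertices, by inclusion-exclusion. Some last vertex `w` does at least
    -- as well as the average; the induction handles `S ∖ w` and `extend` accounts for `w`.
    long-chain : ∀ k S → size S ≡ k →
      ∃ λ cs → All (λ u → S u ≡ true) cs × IsChain cs ×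
        Φ ¬in S + Φ ¬out S ≤ D * length cs + Φ ¬both S
    long-chain zero S ∣S∣≡0 = [] , [] , [] ,
      ≤-trans (≤-reflexive (cong₂ _+_ (Φ≡0 ¬in) (Φ≡0 ¬out))) z≤n
      where
      zero-term : ∀ v x → ind (S v) * x ≡ 0
      zero-term v x with S v | term≤∑ v (ind ∘ S)
      ... | false | _  = refl
      ... | true  | le rewrite ∣S∣≡0 with () ← le
      Φ≡0 : ∀ P → Φ P S ≡ 0
      Φ≡0 P = trans (∑-cong V (λ v → zero-term v _)) (trans (∑-const V 0) (*-zeroʳ (length V)))
    long-chain (suc k) S ∣S∣≡ = proceed
      where
      -- `X w ≤ Y w` says that conditioning on `w` being last does not lower the expectation, with
      -- the two negative `¬both` terms moved across.
      X Y : Fin M → ℕ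
      X w = Φ ¬in S + Φ ¬out S + (Φ ¬both (S ∖ w) + ind (cnt S (¬both w) ≡ᵇ 1) * D)
      Y w = Φ ¬in (S ∖ w) + ind (cnt S (¬in w) ≡ᵇ 1) * D
          + (Φ ¬out (S ∖ w) + ind (cnt S (¬out w) ≡ᵇ 1) * D) + Φ ¬both S

      ∑-S : ∀ (c : ℕ) → ∑ V (λ w → ind (S w) * c) ≡ size S * c
      ∑-S c = ∑-*ʳ V c _

      ∑-split : ∀ (f g : Fin M → ℕ) → ∑ V (λ w → ind (S w) * (f w + g w))
        ≡ ∑ V (λ w → ind (S w) * f w) + ∑ V (λ w → ind (S w) * g w)
      ∑-split f g = trans (∑-cong V λ w → *-distribˡ-+ (ind (S w)) (f w) (g w)) (∑-+ V _ _)

      ∑X≡∑Y : ∑ V (λ w → ind (S w) * X w) ≡ ∑ V (λ w → ind (S w) * Y w)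
      ∑X≡∑Y = begin
        ∑ V (λ w → ind (S w) * X w)
          ≡⟨ ∑-split _ _ ⟩
        ∑ V (λ w → ind (S w) * (Φ ¬in S + Φ ¬out S))
          + ∑ V (λ w → ind (S w) * (Φ ¬both (S ∖ w) + ind (cnt S (¬both w) ≡ᵇ 1) * D))
          ≡⟨ cong₂ _+_ (∑-S _) (Φ-average ¬both ¬both-refl S) ⟩
        size S * (Φ ¬in S + Φ ¬out S) + size S * Φ ¬both S
          ≡⟨ cong (_+ size S * Φ ¬both S) (*-distribˡ-+ (size S) _ _) ⟩
        size S * Φ ¬in S + size S * Φ ¬out S + size S * Φ ¬both S
          ≡⟨ cong₂ _+_ (cong₂ _+_ (Φ-average ¬in ¬in-refl S) (Φ-average ¬out ¬in-refl S)) (∑-S _) ⟨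
        ∑ V (λ w → ind (S w) * (Φ ¬in (S ∖ w) + ind (cnt S (¬in w) ≡ᵇ 1) * D))
          + ∑ V (λ w → ind (S w) * (Φ ¬out (S ∖ w) + ind (cnt S (¬out w) ≡ᵇ 1) * D))
          + ∑ V (λ w → ind (S w) * Φ ¬both S)
          ≡⟨ cong (_+ ∑ V (λ w → ind (S w) * Φ ¬both S)) (∑-split _ _) ⟨
        ∑ V (λ w → ind (S w) * (Φ ¬in (S ∖ w) + ind (cnt S (¬in w) ≡ᵇ 1) * D
                                + (Φ ¬out (S ∖ w) + ind (cnt S (¬out w) ≡ᵇ 1) * D)))
          + ∑ V (λ w → ind (S w) * Φ ¬both S)
          ≡⟨ ∑-split _ _ ⟨
        ∑ V (λ w → ind (S w) * Y w) ∎
        where open ≡-Reasoning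

      -- Outside `S` both summands vanish, so a weak pigeonhole could return a vertex outside `S`.
      -- Adding 1 makes the comparison strict, because `S` is nonempty, and thereby forces `w` into
      -- `S` while still giving `X w ≤ Y w`.
      ∑X<∑[1+Y] : ∑ V (λ w → ind (S w) * X w) < ∑ V (λ w → ind (S w) * (1 + Y w))
      ∑X<∑[1+Y] = begin-strict
        ∑ V (λ w → ind (S w) * X w)                    ≡⟨ ∑X≡∑Y ⟩
        ∑ V (λ w → ind (S w) * Y w)                    <⟨ m<n+m _ {suc k} (s≤s z≤n) ⟩
        suc k + ∑ V (λ w → ind (S w) * Y w)
          ≡⟨ cong (_+ ∑ V (λ w → ind (S w) * Y w)) (trans (∑-S 1) (trans (*-identityʳ _) ∣S∣≡)) ⟨
        ∑ V (λ w → ind (S w) * 1) + ∑ V (λ w → ind (S w) * Y w)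
          ≡⟨ ∑-split _ _ ⟨
        ∑ V (λ w → ind (S w) * (1 + Y w)) ∎
        where open ≤-Reasoning

      ind-cancel : ∀ b x y → ind b * x < ind b * (1 + y) → b ≡ true × x ≤ y
      ind-cancel true x y lt rewrite +-identityʳ x | +-identityʳ y with s≤s le ← lt = refl , le

      arith : ∀ D P N Pi Po N' a b c l l' → P + (N' + c * D) ≤ Pi + a * D + (Po + b * D) + N →
        Pi + Po ≤ D * l + N' → l + a + b ≤ l' + c → P ≤ D * l' + N
      arith D P N Pi Po N' a b c l l' le₁ le₂ le₃ = +-cancelʳ-≤ (N' + c * D) _ _ (begin
        P + (N' + c * D)                          ≤⟨ le₁ ⟩
        Pi + a * D + (Po + b * D) + N             ≡⟨ eq₁ Pi Po a b D N ⟩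
        Pi + Po + ((a + b) * D + N)               ≤⟨ +-monoˡ-≤ ((a + b) * D + N) le₂ ⟩
        D * l + N' + ((a + b) * D + N)            ≡⟨ eq₂ D l N' a b N ⟩
        D * (l + a + b) + (N' + N)                ≤⟨ +-monoˡ-≤ (N' + N) (*-monoʳ-≤ D le₃) ⟩
        D * (l' + c) + (N' + N)                   ≡⟨ eq₃ D l' c N' N ⟩
        D * l' + N + (N' + c * D)                 ∎)
        where
        open ≤-Reasoning
        eq₁ : ∀ Pi Po a b D N → Pi + a * D + (Po + b * D) + N ≡ Pi + Po + ((a + b) * D + N)
        eq₁ = solve-∀
        eq₂ : ∀ D l N' a b N → D * l + N' + ((a + b) * D + N) ≡ D * (l + a + b) + (N' + N)
        eq₂ = solve-∀
        eq₃ : ∀ D l' c N' N → D * (l' + c) + (N' + N) ≡ D * l' + N + (N' + c * D)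
        eq₃ = solve-∀

      proceed : ∃ λ cs → All (λ u → S u ≡ true) cs × IsChain cs ×
        Φ ¬in S + Φ ¬out S ≤ D * length cs + Φ ¬both S
      proceed with ∑-pigeonhole-< V _ _ ∑X<∑[1+Y]
      ... | w , lt with ind-cancel (S w) (X w) (Y w) lt
      ...   | Sw , X≤Y with long-chain k (S ∖ w) (suc-injective (trans (sym (size-∖ S w Sw)) ∣S∣≡))
      ...     | cs , cs⊆ , chain , le with extend S w Sw cs cs⊆ chain
      ...       | cs⁺ , cs⁺⊆ , chain⁺ , le⁺ = cs⁺ , cs⁺⊆ , chain⁺ ,
        arith D (Φ ¬in S + Φ ¬out S) (Φ ¬both S) (Φ ¬in (S ∖ w)) (Φ ¬out (S ∖ w)) (Φ ¬both (S ∖ w))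
          _ _ _ (length cs) (length cs⁺) X≤Y le le⁺

-- With α = ν + p, β = ν + q and μ = ν + p + q this is 1/α + 1/β − 1/μ ≥ 3 / (2α + 2β − μ), with denominators cleared.
reciprocal-poly-ordered : ∀ ν p d → let q = p + d; α = ν + p; β = ν + q; μ = ν + p + q; c = 3 * ν + p + q in
  3 * (α * β * μ) + c * (α * β) ≤ c * (β * μ + α * μ)
-- The slack is the third summand on the left of `eq`. Written in `p` and `q` its coefficient of `ν`
-- is 2p² - 2pq + 2q²; substituting `q = p + d` leaves only nonnegative coefficients.
reciprocal-poly-ordered ν p d = ≤-trans (m≤m+n _ _) (≤-reflexive (eq ν p d))
  where
  eq : ∀ ν p d →
    3 * ((ν + p) * (ν + (p + d)) * (ν + p + (p + d))) + (3 * ν + p + (p + d)) * ((ν + p) * (ν + (p + d)))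
      + (ν * ν * (2 * p + d) + ν * (2 * p * p + 2 * p * d + 2 * d * d) + (2 * p + d) * (d * d))
    ≡ (3 * ν + p + (p + d)) * ((ν + (p + d)) * (ν + p + (p + d)) + (ν + p) * (ν + p + (p + d)))
  eq = solve-∀

reciprocal-poly : ∀ ν p q → let α = ν + p; β = ν + q; μ = ν + p + q; c = 3 * ν + p + q in
  3 * (α * β * μ) + c * (α * β) ≤ c * (β * μ + α * μ)
reciprocal-poly ν p q with ≤-total p q
... | inj₁ p≤q = subst
  (λ q → 3 * ((ν + p) * (ν + q) * (ν + p + q)) + (3 * ν + p + q) * ((ν + p) * (ν + q))
    ≤ (3 * ν + p + q) * ((ν + q) * (ν + p + q) + (ν + p) * (ν + p + q)))
  (m+[n∸m]≡n p≤q) (reciprocal-poly-ordered ν p (q ∸ p))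
... | inj₂ q≤p = subst₂ _≤_ (eqˡ ν p q) (eqʳ ν p q) (subst
  (λ p → 3 * ((ν + q) * (ν + p) * (ν + q + p)) + (3 * ν + q + p) * ((ν + q) * (ν + p))
    ≤ (3 * ν + q + p) * ((ν + p) * (ν + q + p) + (ν + q) * (ν + q + p)))
  (m+[n∸m]≡n q≤p) (reciprocal-poly-ordered ν q (p ∸ q)))
  where
  eqˡ : ∀ ν p q → 3 * ((ν + q) * (ν + p) * (ν + q + p)) + (3 * ν + q + p) * ((ν + q) * (ν + p))
    ≡ 3 * ((ν + p) * (ν + q) * (ν + p + q)) + (3 * ν + p + q) * ((ν + p) * (ν + q))
  eqˡ = solve-∀
  eqʳ : ∀ ν p q → (3 * ν + q + p) * ((ν + p) * (ν + q + p) + (ν + q) * (ν + q + p))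
    ≡ (3 * ν + p + q) * ((ν + q) * (ν + p + q) + (ν + p) * (ν + p + q))
  eqʳ = solve-∀

-- Here `a`, `b`, `m` stand for `D` divided by α, β, μ. Multiplying by αβμ and replacing each
-- product by `D` reduces the claim to `reciprocal-poly`.
reciprocal-ineq : ∀ ν p q D a b m → 0 < ν →
  (ν + p) * a ≡ D → (ν + q) * b ≡ D → (ν + p + q) * m ≡ D →
  3 * D + (3 * ν + p + q) * m ≤ (3 * ν + p + q) * (a + b)
reciprocal-ineq ν@(suc _) p q D a b m _ αa βb μm = *-cancelˡ-≤ (α * β * μ) (begin
  α * β * μ * (3 * D + c * m)          ≡⟨ eq₁ α β μ D c m ⟩
  α * β * μ * 3 * D + c * (α * β) * (μ * m) ≡⟨ cong (λ x → α * β * μ * 3 * D + c * (α * β) * x) μm ⟩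
  α * β * μ * 3 * D + c * (α * β) * D  ≡⟨ eq₂ (α * β * μ) D (c * (α * β)) ⟩
  (3 * (α * β * μ) + c * (α * β)) * D  ≤⟨ *-monoˡ-≤ D (reciprocal-poly ν p q) ⟩
  c * (β * μ + α * μ) * D              ≡⟨ eq₃ c α β μ D ⟩
  c * (β * μ) * D + c * (α * μ) * D    ≡⟨ cong₂ (λ x y → c * (β * μ) * x + c * (α * μ) * y) αa βb ⟨
  c * (β * μ) * (α * a) + c * (α * μ) * (β * b) ≡⟨ eq₄ c α β μ a b ⟩
  α * β * μ * (c * (a + b)) ∎)
  where
  open ≤-Reasoning
  α β μ c : ℕ
  α = ν + p
  β = ν + q
  μ = ν + p + q
  c = 3 * ν + p + q
  eq₁ : ∀ α β μ D c m → α * β * μ * (3 * D + c * m) ≡ α * β * μ * 3 * D + c * (α * β) * (μ * m)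
  eq₁ = solve-∀
  eq₂ : ∀ x D y → x * 3 * D + y * D ≡ (3 * x + y) * D
  eq₂ = solve-∀
  eq₃ : ∀ c α β μ D → c * (β * μ + α * μ) * D ≡ c * (β * μ) * D + c * (α * μ) * D
  eq₃ = solve-∀
  eq₄ : ∀ c α β μ a b → c * (β * μ) * (α * a) + c * (α * μ) * (β * b) ≡ α * β * μ * (c * (a + b))
  eq₄ = solve-∀

2xy≤x²+y² : ∀ x y → 2 * (x * y) ≤ x * x + y * y
2xy≤x²+y² x y with ≤-total x y
... | inj₁ x≤y = subst (λ y → 2 * (x * y) ≤ x * x + y * y) (m+[n∸m]≡n x≤y)
  (≤-trans (m≤m+n _ ((y ∸ x) * (y ∸ x))) (≤-reflexive (eq x (y ∸ x))))
  where
  eq : ∀ x d → 2 * (x * (x + d)) + d * d ≡ x * x + (x + d) * (x + d)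
  eq = solve-∀
... | inj₂ y≤x = subst (λ x → 2 * (x * y) ≤ x * x + y * y) (m+[n∸m]≡n y≤x)
  (≤-trans (m≤m+n _ ((x ∸ y) * (x ∸ y))) (≤-reflexive (eq y (x ∸ y))))
  where
  eq : ∀ y d → 2 * ((y + d) * y) + d * d ≡ (y + d) * (y + d) + y * y
  eq = solve-∀

-- The tangent at the mean C / M of x ↦ 1 / x, evaluated at c.
tangent-ineq : ∀ M C D c x y → 0 < c → 3 * D + c * y ≤ c * x →
  6 * D * C * M + C * C * y ≤ C * C * x + 3 * D * (M * M) * c
tangent-ineq M C D c@(suc _) x y _ le = *-cancelˡ-≤ c (begin
  c * (6 * D * C * M + C * C * y)                         ≡⟨ eq₁ c D C M y ⟩
  3 * D * (2 * (C * (M * c))) + C * C * (c * y)           ≤⟨ +-monoˡ-≤ _ (*-monoʳ-≤ (3 * D) (2xy≤x²+y² C (M * c))) ⟩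
  3 * D * (C * C + M * c * (M * c)) + C * C * (c * y)     ≡⟨ eq₂ c D C M y ⟩
  C * C * (3 * D + c * y) + 3 * D * (M * c * (M * c))     ≤⟨ +-monoˡ-≤ _ (*-monoʳ-≤ (C * C) le) ⟩
  C * C * (c * x) + 3 * D * (M * c * (M * c))             ≡⟨ eq₃ c D C M x ⟩
  c * (C * C * x + 3 * D * (M * M) * c)                   ∎)
  where
  open ≤-Reasoning
  eq₁ : ∀ c D C M y → c * (6 * D * C * M + C * C * y) ≡ 3 * D * (2 * (C * (M * c))) + C * C * (c * y)
  eq₁ = solve-∀
  eq₂ : ∀ c D C M y → 3 * D * (C * C + M * c * (M * c)) + C * C * (c * y)
    ≡ C * C * (3 * D + c * y) + 3 * D * (M * c * (M * c))
  eq₂ = solve-∀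
  eq₃ : ∀ c D C M x → C * C * (c * x) + 3 * D * (M * c * (M * c)) ≡ c * (C * C * x + 3 * D * (M * M) * c)
  eq₃ = solve-∀

-- cost u v = 3 − w u v, where w is 3 on a double edge, 2 on a single one and 0 on a non-edge or a diagonal pair.
cost : Bool → Bool → ℕ
cost true  true  = 0
cost false false = 3
cost _     _     = 1

totalCost : ∀ {n} → (Fin n → Fin n → Bool) → ℕ
totalCost {n} adj = ∑[ v ∈ allFin n ] ∑[ u ∈ allFin n ] cost (adj u v) (adj v u)

module _ {M : ℕ} (adj : Fin M → Fin M → Bool) (irr : ∀ v → adj v v ≡ false) where
  open Chains adj irr

  module VertexCounts (v : Fin M) where
    V = allFin M
    ν p q c : ℕ
    ν = ∑[ u ∈ V ] ind (not (adj u v) ∧ not (adj v u))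
    p = ∑[ u ∈ V ] ind (not (adj u v) ∧ adj v u)
    q = ∑[ u ∈ V ] ind (adj u v ∧ not (adj v u))
    c = ∑[ u ∈ V ] cost (adj u v) (adj v u)

    0<ν : 0 < ν
    -- The vertex `v` counts among its own non-neighbours.
    0<ν = ≤-trans (≤-reflexive (cong (λ b → ind (not b ∧ not b)) (sym (irr v)))) (term≤∑ v _)

    all : Fin M → Bool
    all _ = true

    ¬in-cnt : cnt all (¬in v) ≡ ν + p
    ¬in-cnt = trans (∑-cong V pointwise) (∑-+ V _ _)
      where
      pointwise : ∀ u → ind (not (adj u v)) + 0
        ≡ ind (not (adj u v) ∧ not (adj v u)) + ind (not (adj u v) ∧ adj v u)
      pointwise u with adj u v | adj v u
      ... | true  | _     = refl
      ... | false | true  = refl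
      ... | false | false = refl

    ¬out-cnt : cnt all (¬out v) ≡ ν + q
    ¬out-cnt = trans (∑-cong V pointwise) (∑-+ V _ _)
      where
      pointwise : ∀ u → ind (not (adj v u)) + 0
        ≡ ind (not (adj u v) ∧ not (adj v u)) + ind (adj u v ∧ not (adj v u))
      pointwise u with adj u v | adj v u
      ... | true  | true  = refl
      ... | true  | false = refl
      ... | false | true  = refl
      ... | false | false = refl

    ¬both-cnt : cnt all (¬both v) ≡ ν + p + q
    ¬both-cnt = trans (∑-cong V pointwise) (trans (∑-+ V _ _) (cong (_+ q) (∑-+ V _ _)))
      where
      pointwise : ∀ u → ind (not (adj u v ∧ adj v u)) + 0
        ≡ ind (not (adj u v) ∧ not (adj v u)) + ind (not (adj u v) ∧ adj v u) + ind (adj u v ∧ not (adj v u))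
      pointwise u with adj u v | adj v u
      ... | true  | true  = refl
      ... | true  | false = refl
      ... | false | true  = refl
      ... | false | false = refl

    c≡ : c ≡ 3 * ν + p + q
    c≡ = trans (∑-cong V pointwise)
      (trans (∑-+ V _ _) (cong (_+ q) (trans (∑-+ V _ _) (cong (_+ p) (∑-*ˡ V 3 _)))))
      where
      pointwise : ∀ u → cost (adj u v) (adj v u)
        ≡ 3 * ind (not (adj u v) ∧ not (adj v u)) + ind (not (adj u v) ∧ adj v u) + ind (adj u v ∧ not (adj v u))
      pointwise u with adj u v | adj v u
      ... | true  | true  = refl
      ... | true  | false = refl
      ... | false | true  = refl
      ... | false | false = refl

  -- The tangent form of Cauchy-Schwarz: since the costs of the vertices sum to `C`, adding the
  -- tangents over all `v` gives (6 - 3) `D` M² / `C` as a lower bound for `D` times the expected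
  -- size, and `long-chain` attains it. `D` is `M !` so that every j from 1 to `M` divides it.
  transitive-chain : ∃ λ cs → IsChain cs × 3 * (M * M) ≤ length cs * totalCost adj
  transitive-chain with 1 ≤? M
  ... | no M≮1 = [] , [] , ≤-reflexive (cong (λ m → 3 * (m * m)) (n<1⇒n≡0 (≰⇒> M≮1)))
  ... | yes 0<M = bound (long-chain D h h-spec (size all) all refl)
    where
    V : List (Fin M)
    V = allFin M
    all : Fin M → Bool
    all _ = true
    D C : ℕ
    D = M !
    C = totalCost adj
    length-V : length V ≡ M
    length-V = length-tabulate id
    h : ℕ → ℕ
    h zero    = 0
    h (suc j) = D / suc j
    h-spec : ∀ j → j < M → suc j * h (suc j) ≡ D
    h-spec j j<M = m*[n/m]≡n {suc j} {D} (∣-trans (m∣m*n (j !)) (m≤n⇒m!∣n! j<M))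
    open Reciprocal M D h h-spec using (Φ; cnt-≤; size≤M)
    open VertexCounts using (0<ν; c≡; ¬in-cnt; ¬out-cnt; ¬both-cnt)

    spec : ∀ k P → 0 < k → cnt all P ≡ k → k * h (cnt all P) ≡ D
    spec (suc j) P _ eq = trans (cong (λ x → suc j * h x) eq)
      (h-spec j (≤-trans (≤-reflexive (sym eq)) (≤-trans (cnt-≤ all P) (size≤M all))))

    pointwise : ∀ v → 6 * D * C * M + C * C * h (cnt all (¬both v))
      ≤ C * C * (h (cnt all (¬in v)) + h (cnt all (¬out v))) + 3 * D * (M * M) * (∑[ u ∈ V ] cost (adj u v) (adj v u))
    pointwise v rewrite c≡ v = tangent-ineq M C D (3 * ν + p + q) _ _
      (≤-trans (0<ν v) (≤-trans (m≤m+n ν _) (≤-trans (m≤m+n _ p) (m≤m+n _ q))))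
      (reciprocal-ineq ν p q D _ _ _ (0<ν v)
        (spec (ν + p) (¬in v) (≤-trans (0<ν v) (m≤m+n ν p)) (¬in-cnt v))
        (spec (ν + q) (¬out v) (≤-trans (0<ν v) (m≤m+n ν q)) (¬out-cnt v))
        (spec (ν + p + q) (¬both v) (≤-trans (0<ν v) (≤-trans (m≤m+n ν p) (m≤m+n _ q))) (¬both-cnt v)))
      where open VertexCounts v using (ν; p; q)

    Φ-all : ∀ P → Φ P all ≡ ∑[ v ∈ V ] h (cnt all (P v))
    Φ-all P = ∑-cong V λ v → +-identityʳ _

    summed : M * (6 * D * C * M) + C * C * Φ ¬both all ≤ C * C * (Φ ¬in all + Φ ¬out all) + 3 * D * (M * M) * C
    summed = begin
      M * (6 * D * C * M) + C * C * Φ ¬both all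
        ≡⟨ cong₂ _+_ (trans (∑-const V _) (cong (_* (6 * D * C * M)) length-V))
             (trans (∑-*ˡ V (C * C) _) (cong (C * C *_) (sym (Φ-all ¬both)))) ⟨
      ∑ V (λ v → 6 * D * C * M) + ∑ V (λ v → C * C * h (cnt all (¬both v)))
        ≡⟨ ∑-+ V _ _ ⟨
      ∑ V (λ v → 6 * D * C * M + C * C * h (cnt all (¬both v)))
        ≤⟨ ∑-mono V pointwise ⟩
      ∑ V (λ v → C * C * (h (cnt all (¬in v)) + h (cnt all (¬out v)))
                 + 3 * D * (M * M) * (∑[ u ∈ V ] cost (adj u v) (adj v u)))
        ≡⟨ ∑-+ V _ _ ⟩
      ∑ V (λ v → C * C * (h (cnt all (¬in v)) + h (cnt all (¬out v))))
        + ∑ V (λ v → 3 * D * (M * M) * (∑[ u ∈ V ] cost (adj u v) (adj v u)))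
        ≡⟨ cong₂ _+_ (trans (∑-*ˡ V (C * C) _) (cong (C * C *_) (trans (∑-+ V _ _)
             (cong₂ _+_ (sym (Φ-all ¬in)) (sym (Φ-all ¬out))))))
             (∑-*ˡ V (3 * D * (M * M)) _) ⟩
      C * C * (Φ ¬in all + Φ ¬out all) + 3 * D * (M * M) * C ∎
      where open ≤-Reasoning

    0<C : 0 < C
    0<C = ≤-trans (0<ν v₀) (≤-trans (≤-trans (≤-trans (m≤m+n _ _) (m≤m+n _ _)) (m≤m+n _ _))
      (≤-trans (≤-reflexive (sym (c≡ v₀))) (term≤∑ v₀ _)))
      where
      v₀ : Fin M
      v₀ = Fin.fromℕ< 0<M

    arith : ∀ C D x y l → 0 < C → 0 < D → M * (6 * D * C * M) + C * C * y ≤ C * C * x + 3 * D * (M * M) * C →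
      x ≤ D * l + y → 3 * (M * M) ≤ l * C
    arith C@(suc _) D@(suc _) x y l _ _ le₁ le₂ = *-cancelˡ-≤ (D * C)
      (+-cancelʳ-≤ (C * C * y + 3 * D * (M * M) * C) _ _ (begin
        D * C * (3 * (M * M)) + (C * C * y + 3 * D * (M * M) * C) ≡⟨ eq₁ D C M y ⟩
        M * (6 * D * C * M) + C * C * y                           ≤⟨ le₁ ⟩
        C * C * x + 3 * D * (M * M) * C                           ≤⟨ +-monoˡ-≤ _ (*-monoʳ-≤ (C * C) le₂) ⟩
        C * C * (D * l + y) + 3 * D * (M * M) * C                 ≡⟨ eq₂ D C M y l ⟩
        D * C * (l * C) + (C * C * y + 3 * D * (M * M) * C)       ∎))
      where
      open ≤-Reasoning
      eq₁ : ∀ D C M y → D * C * (3 * (M * M)) + (C * C * y + 3 * D * (M * M) * C) ≡ M * (6 * D * C * M) + C * C * y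
      eq₁ = solve-∀
      eq₂ : ∀ D C M y l → C * C * (D * l + y) + 3 * D * (M * M) * C
        ≡ D * C * (l * C) + (C * C * y + 3 * D * (M * M) * C)
      eq₂ = solve-∀

    bound : (∃ λ cs → _ × IsChain cs × Φ ¬in all + Φ ¬out all ≤ D * length cs + Φ ¬both all) →
      ∃ λ cs → IsChain cs × 3 * (M * M) ≤ length cs * C
    bound (cs , _ , chain , le) = cs , chain ,
      arith C D _ _ (length cs) 0<C (1≤n! M) summed le

-- Boxes in dense relations

tuples : List A → (k : ℕ) → List (Vec A k)
tuples xs zero    = [] ∷ []
tuples xs (suc k) = cartesianProductWith _∷_ xs (tuples xs k)

∑-tuples : ∀ (xs : List A) k f → ∑ (tuples xs (suc k)) f ≡ ∑[ x ∈ xs ] ∑[ s ∈ tuples xs k ] f (x ∷ s)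
∑-tuples xs k f = go xs
  where
  go : ∀ ys → ∑ (cartesianProductWith _∷_ ys (tuples xs k)) f ≡ ∑[ x ∈ ys ] ∑[ s ∈ tuples xs k ] f (x ∷ s)
  go []       = refl
  go (y ∷ ys) = trans (∑-++ (List.map (y ∷_) (tuples xs k)) _ f) (cong₂ _+_ (∑-map (tuples xs k) (y ∷_) f) (go ys))

∑-allFin-const : ∀ n c → ∑ (allFin n) (λ _ → c) ≡ n * c
∑-allFin-const n c = trans (∑-const (allFin n) c) (cong (_* c) length≡n)
  where
  length≡n : length (allFin n) ≡ n
  length≡n = length-tabulate id

∑-tuples-const : ∀ n k c → ∑ (tuples (allFin n) k) (λ _ → c) ≡ n ^ k * c
∑-tuples-const n zero    c = refl
∑-tuples-const n (suc k) c = begin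
  ∑ (tuples (allFin n) (suc k)) (λ _ → c)  ≡⟨ ∑-tuples (allFin n) k _ ⟩
  ∑ (allFin n) (λ _ → ∑ (tuples (allFin n) k) (λ _ → c)) ≡⟨ ∑-allFin-const n _ ⟩
  n * ∑ (tuples (allFin n) k) (λ _ → c)    ≡⟨ cong (n *_) (∑-tuples-const n k c) ⟩
  n * (n ^ k * c)                          ≡⟨ *-assoc n (n ^ k) c ⟨
  n ^ suc k * c                            ∎
  where open ≡-Reasoning

length-tuples : ∀ n k → length (tuples (allFin n) k) ≡ n ^ k
length-tuples n k = trans (sym (*-identityʳ _)) (trans (sym (∑-const (tuples (allFin n) k) 1))
  (trans (∑-tuples-const n k 1) (*-identityʳ _)))

term≤∑-tuples : ∀ (s : Vec (Fin n) k) f → f s ≤ ∑ (tuples (allFin n) k) f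
term≤∑-tuples []          f = m≤m+n (f []) 0
term≤∑-tuples {n} {suc k} (x ∷ s) f = begin
  f (x ∷ s)                                                ≤⟨ term≤∑-tuples s (f ∘ (x ∷_)) ⟩
  ∑ (tuples (allFin n) k) (f ∘ (x ∷_))                     ≤⟨ term≤∑ x _ ⟩
  (∑[ x ∈ allFin n ] ∑[ s ∈ tuples (allFin n) k ] f (x ∷ s)) ≡⟨ ∑-tuples (allFin n) k f ⟨
  ∑ (tuples (allFin n) (suc k)) f                          ∎
  where open ≤-Reasoning

mem : Fin n → Vec (Fin n) k → Bool
mem x []       = false
mem x (y ∷ ys) = ⌊ x ≟ y ⌋ ∨ mem x ys

distinct : Vec (Fin n) k → Bool
distinct []       = true
distinct (x ∷ xs) = not (mem x xs) ∧ distinct xs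

every : (A → Bool) → Vec A k → Bool
every P []       = true
every P (x ∷ xs) = P x ∧ every P xs

∧-true : ∀ {a b} → a ∧ b ≡ true → a ≡ true × b ≡ true
∧-true {true} {true} _ = refl , refl

every-lookup : ∀ (P : A → Bool) (xs : Vec A k) → every P xs ≡ true → ∀ i → P (lookup xs i) ≡ true
every-lookup P (x ∷ xs) eq Fin.zero    = proj₁ (∧-true eq)
every-lookup P (x ∷ xs) eq (Fin.suc i) = every-lookup P xs (proj₂ (∧-true {P x} eq)) i

mem-lookup : ∀ (xs : Vec (Fin n) k) i → mem (lookup xs i) xs ≡ true
mem-lookup (x ∷ xs) Fin.zero with x ≟ x
... | yes _  = refl
... | no x≢x = contradiction refl x≢x
mem-lookup (x ∷ xs) (Fin.suc i) with lookup xs i ≟ x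
... | yes _ = refl
... | no _  = mem-lookup xs i

distinct⇒injective : ∀ (xs : Vec (Fin n) k) → distinct xs ≡ true → Injective _≡_ _≡_ (lookup xs)
distinct⇒injective (x ∷ xs) d {Fin.zero}  {Fin.zero}  _  = refl
distinct⇒injective (x ∷ xs) d {Fin.zero}  {Fin.suc j} refl with mem x xs | mem-lookup xs j
distinct⇒injective (x ∷ xs) () {Fin.zero} {Fin.suc j} refl | true | refl
distinct⇒injective (x ∷ xs) d {Fin.suc i} {Fin.zero}  refl with mem x xs | mem-lookup xs i
distinct⇒injective (x ∷ xs) () {Fin.suc i} {Fin.zero} refl | true | refl
distinct⇒injective (x ∷ xs) d {Fin.suc i} {Fin.suc j} eq =
  cong Fin.suc (distinct⇒injective xs (proj₂ (∧-true {not (mem x xs)} d)) eq)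

∑-mem : ∀ (ys : Vec (Fin n) k) → ∑[ x ∈ allFin n ] ind (mem x ys) ≤ k
∑-mem {n} []       = ≤-reflexive (trans (∑-allFin-const n 0) (*-zeroʳ n))
∑-mem {n} {suc k} (y ∷ ys) = begin
  (∑[ x ∈ allFin n ] ind (⌊ x ≟ y ⌋ ∨ mem x ys))
    ≤⟨ ∑-mono (allFin n) (λ x → ind-∨ ⌊ x ≟ y ⌋ (mem x ys)) ⟩
  (∑[ x ∈ allFin n ] (ind ⌊ x ≟ y ⌋ * 1 + ind (mem x ys)))
    ≡⟨ ∑-+ (allFin n) _ _ ⟩
  (∑[ x ∈ allFin n ] ind ⌊ x ≟ y ⌋ * 1) + (∑[ x ∈ allFin n ] ind (mem x ys))
    ≤⟨ +-mono-≤ (≤-reflexive (∑-≟ n y (λ _ → 1))) (∑-mem ys) ⟩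
  suc k ∎
  where
  open ≤-Reasoning
  ind-∨ : ∀ a b → ind (a ∨ b) ≤ ind a * 1 + ind b
  ind-∨ true  b = s≤s z≤n
  ind-∨ false b = ≤-refl

-- Choosing the entries one at a time, the entries already chosen exclude at most `t` elements of
-- `P`, so at least `m` choices remain at every step.
count-distinct : ∀ t m (P : Fin n → Bool) → t + m ≤ size P →
  m ^ t ≤ ∑[ xs ∈ tuples (allFin n) t ] ind (distinct xs ∧ every P xs)
count-distinct zero    m P le = s≤s z≤n
count-distinct {n} (suc t) m P le = begin
  m * m ^ t
    ≤⟨ *-monoʳ-≤ m (count-distinct t m P (≤-trans (n≤1+n _) le)) ⟩
  m * ∑ (tuples V t) (λ xs → ind (distinct xs ∧ every P xs))
    ≡⟨ *-comm m _ ⟩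
  ∑ (tuples V t) (λ xs → ind (distinct xs ∧ every P xs)) * m
    ≡⟨ ∑-*ʳ (tuples V t) m _ ⟨
  ∑ (tuples V t) (λ xs → ind (distinct xs ∧ every P xs) * m)
    ≤⟨ ∑-mono (tuples V t) (λ xs → *-monoʳ-≤ (ind (distinct xs ∧ every P xs)) (fresh xs)) ⟩
  ∑ (tuples V t) (λ xs → ind (distinct xs ∧ every P xs) * ∑ V (λ x → ind (P x ∧ not (mem x xs))))
    ≡⟨ ∑-cong (tuples V t) (λ xs → sym (trans (∑-cong V (λ x → factor (P x) (mem x xs) (distinct xs) (every P xs)))
         (∑-*ˡ V (ind (distinct xs ∧ every P xs)) _))) ⟩
  ∑ (tuples V t) (λ xs → ∑ V (λ x → ind (distinct (x ∷ xs) ∧ every P (x ∷ xs))))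
    ≡⟨ ∑-swap (tuples V t) V _ ⟩
  ∑ V (λ x → ∑ (tuples V t) (λ xs → ind (distinct (x ∷ xs) ∧ every P (x ∷ xs))))
    ≡⟨ ∑-tuples V t _ ⟨
  ∑ (tuples V (suc t)) (λ xs → ind (distinct xs ∧ every P xs)) ∎
  where
  open ≤-Reasoning
  V = allFin n
  factor : ∀ p b d e → ind ((not b ∧ d) ∧ (p ∧ e)) ≡ ind (d ∧ e) * ind (p ∧ not b)
  factor true  true  d e = sym (*-zeroʳ (ind (d ∧ e)))
  factor true  false d e = sym (*-identityʳ _)
  factor false true  d e = sym (*-zeroʳ (ind (d ∧ e)))
  factor false false true  e = sym (*-zeroʳ (ind e))
  factor false false false e = refl
  fresh : ∀ (xs : Vec (Fin n) t) → m ≤ ∑ V (λ x → ind (P x ∧ not (mem x xs)))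
  fresh xs = +-cancelˡ-≤ t _ _ (begin
    t + m                                          ≤⟨ n≤1+n _ ⟩
    suc t + m                                      ≤⟨ le ⟩
    size P                                         ≤⟨ ∑-mono V (λ x → either (P x) (mem x xs)) ⟩
    ∑ V (λ x → ind (mem x xs) + ind (P x ∧ not (mem x xs))) ≡⟨ ∑-+ V _ _ ⟩
    ∑ V (λ x → ind (mem x xs)) + ∑ V (λ x → ind (P x ∧ not (mem x xs))) ≤⟨ +-monoˡ-≤ _ (∑-mem xs) ⟩
    t + ∑ V (λ x → ind (P x ∧ not (mem x xs)))     ∎)
    where
    either : ∀ p b → ind p ≤ ind b + ind (p ∧ not b)
    either true  true  = s≤s z≤n
    either true  false = s≤s z≤n
    either false b     = z≤n

-- Each `X i` enumerates a `t`-set without repetition; sets at different positions may overlap.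
Box : (n k t : ℕ) → (Vec (Fin n) k → Bool) → Set
Box n k t R = ∃ λ (X : Fin k → Fin t → Fin n) →
  (∀ i → Injective _≡_ _≡_ (X i)) × (∀ (f : Fin k → Fin t) → R (tabulate λ i → X i (f i)) ≡ true)

-- The Kővári-Sós-Turán double count in the first coordinate. At least a 1/(2K) share of the `y`
-- have degree at least n/(2K). As `n` is at least `4 * K * t`, removing `t` from such a degree
-- leaves n/(4K), so a popular `y` sees at least (n/(4K))^t distinct `t`-tuples. Averaging over all
-- n^t tuples `xs` yields one with the stated share.
dense-link : ∀ n k t K → 1 ≤ n → 4 * K * t ≤ n → (R : Vec (Fin n) (suc k) → Bool) →
  n ^ suc k ≤ K * ∑ (tuples (allFin n) (suc k)) (ind ∘ R) →
  ∃ λ (xs : Vec (Fin n) t) →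
    n ^ k ≤ 2 * K * (4 * K) ^ t * (∑[ y ∈ tuples (allFin n) k ] ind (distinct xs ∧ every (λ x → R (x ∷ y)) xs))
dense-link n@(suc _) k t K _ 4Kt≤n R dense = ∑-pigeonhole-≤ (tuples V t) (λ _ → N) (λ xs → K' * link xs)
    (≤-trans (m^n>0 n t) (≤-reflexive (sym (length-tuples n t)))) (begin
  ∑ (tuples V t) (λ _ → N)                    ≡⟨ ∑-tuples-const n t N ⟩
  n ^ t * N                                   ≤⟨ *-monoʳ-≤ (n ^ t) popular-count ⟩
  n ^ t * (2 * K * ∑ Y (ind ∘ popular))       ≡⟨ eq₁ (n ^ t) K _ ⟩
  2 * K * (∑ Y (ind ∘ popular) * n ^ t)       ≡⟨ cong (2 * K *_) (∑-*ʳ Y (n ^ t) _) ⟨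
  2 * K * ∑ Y (λ y → ind (popular y) * n ^ t) ≤⟨ *-monoʳ-≤ (2 * K) (∑-mono Y popular-tuples) ⟩
  2 * K * ∑ Y (λ y → (4 * K) ^ t * c y)       ≡⟨ cong (2 * K *_) (∑-*ˡ Y ((4 * K) ^ t) c) ⟩
  2 * K * ((4 * K) ^ t * ∑ Y c)               ≡⟨ *-assoc (2 * K) _ _ ⟨
  K' * ∑ Y c                                  ≡⟨ cong (K' *_) (∑-swap Y (tuples V t) _) ⟩
  K' * ∑ (tuples V t) link                    ≡⟨ ∑-*ˡ (tuples V t) K' link ⟨
  ∑ (tuples V t) (λ xs → K' * link xs)        ∎)
  where
  open ≤-Reasoning
  V = allFin n
  Y = tuples V k
  N K' : ℕ
  N = n ^ k
  K' = 2 * K * (4 * K) ^ t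
  link : Vec (Fin n) t → ℕ
  link xs = ∑[ y ∈ Y ] ind (distinct xs ∧ every (λ x → R (x ∷ y)) xs)
  deg c : Vec (Fin n) k → ℕ
  deg y = size (λ x → R (x ∷ y))
  c y = ∑[ xs ∈ tuples V t ] ind (distinct xs ∧ every (λ x → R (x ∷ y)) xs)
  popular : Vec (Fin n) k → Bool
  popular y = ⌊ n ≤? 2 * K * deg y ⌋

  eq₁ : ∀ a K b → a * (2 * K * b) ≡ 2 * K * (b * a)
  eq₁ = solve-∀

  -- A popular `y` is bounded by the full degree `n`. The unpopular ones contribute at most `n`
  -- each, at most half of the total `2 * K * ∑ Y deg`.
  deg≤ : ∀ y → 2 * K * deg y ≤ 2 * K * n * ind (popular y) + n
  deg≤ y with n ≤? 2 * K * deg y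
  ... | no n≰  = ≤-trans (<⇒≤ (≰⇒> n≰)) (m≤n+m n _)
  ... | yes _ = ≤-trans (*-monoʳ-≤ (2 * K) deg≤n) (≤-trans (≤-reflexive (sym (*-identityʳ _))) (m≤m+n _ n))
    where
    deg≤n : deg y ≤ n
    deg≤n = ≤-trans (∑-mono V (λ x → ind≤1 (R (x ∷ y)))) (≤-reflexive (trans (∑-allFin-const n 1) (*-identityʳ n)))

  ∑deg : n * N ≤ K * ∑ Y deg
  ∑deg = ≤-trans dense (≤-reflexive (cong (K *_) (trans (∑-tuples V k _) (∑-swap V Y _))))

  popular-count : N ≤ 2 * K * ∑ Y (ind ∘ popular)
  popular-count = *-cancelˡ-≤ n (+-cancelʳ-≤ (n * N) _ _ (begin
    n * N + n * N                                        ≤⟨ +-mono-≤ ∑deg ∑deg ⟩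
    K * ∑ Y deg + K * ∑ Y deg                            ≡⟨ eq₃ K (∑ Y deg) ⟩
    2 * K * ∑ Y deg                                      ≡⟨ ∑-*ˡ Y (2 * K) deg ⟨
    ∑ Y (λ y → 2 * K * deg y)                            ≤⟨ ∑-mono Y deg≤ ⟩
    ∑ Y (λ y → 2 * K * n * ind (popular y) + n)          ≡⟨ ∑-+ Y _ _ ⟩
    ∑ Y (λ y → 2 * K * n * ind (popular y)) + ∑ Y (λ _ → n)
      ≡⟨ cong₂ _+_ (∑-*ˡ Y (2 * K * n) _) (trans (∑-tuples-const n k n) (*-comm N n)) ⟩
    2 * K * n * ∑ Y (ind ∘ popular) + n * N              ≡⟨ cong (_+ n * N) (eq₄ K n _) ⟩
    n * (2 * K * ∑ Y (ind ∘ popular)) + n * N            ∎))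
    where
    eq₃ : ∀ K x → K * x + K * x ≡ 2 * K * x
    eq₃ = solve-∀
    eq₄ : ∀ K n x → 2 * K * n * x ≡ n * (2 * K * x)
    eq₄ = solve-∀

  ^-distribʳ-* : ∀ a b t → (a * b) ^ t ≡ a ^ t * b ^ t
  ^-distribʳ-* a b zero    = refl
  ^-distribʳ-* a b (suc t) = trans (cong (a * b *_) (^-distribʳ-* a b t)) (eq a b (a ^ t) (b ^ t))
    where
    eq : ∀ a b c d → a * b * (c * d) ≡ a * c * (b * d)
    eq = solve-∀

  popular-tuples : ∀ y → ind (popular y) * n ^ t ≤ (4 * K) ^ t * c y
  popular-tuples y with n ≤? 2 * K * deg y
  ... | no _   = z≤n
  ... | yes n≤ = begin
    n ^ t + 0                    ≡⟨ +-identityʳ _ ⟩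
    n ^ t                        ≤⟨ ^-monoˡ-≤ t n≤4Km ⟩
    (4 * K * m) ^ t              ≡⟨ ^-distribʳ-* (4 * K) m t ⟩
    (4 * K) ^ t * m ^ t          ≤⟨ *-monoʳ-≤ ((4 * K) ^ t) (count-distinct t m (λ x → R (x ∷ y)) (≤-reflexive (m+[n∸m]≡n t≤deg))) ⟩
    (4 * K) ^ t * c y            ∎
    where
    m : ℕ
    m = deg y ∸ t
    2n≤ : n + n ≤ 4 * K * deg y
    2n≤ = ≤-trans (+-mono-≤ n≤ n≤) (≤-reflexive (eq K (deg y)))
      where
      eq : ∀ K d → 2 * K * d + 2 * K * d ≡ 4 * K * d
      eq = solve-∀
    t≤deg : t ≤ deg y
    t≤deg with ≤-total t (deg y)
    ... | inj₁ le = le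
    ... | inj₂ ge = contradiction (≤-trans 2n≤ (≤-trans (*-monoʳ-≤ (4 * K) ge) 4Kt≤n)) (<⇒≱ (m<m+n n (s≤s z≤n)))
    n≤4Km : n ≤ 4 * K * m
    n≤4Km = +-cancelˡ-≤ n _ _ (begin
      n + n                        ≤⟨ 2n≤ ⟩
      4 * K * deg y                ≡⟨ cong (4 * K *_) (m+[n∸m]≡n t≤deg) ⟨
      4 * K * (t + m)              ≡⟨ *-distribˡ-+ (4 * K) t m ⟩
      4 * K * t + 4 * K * m        ≤⟨ +-monoˡ-≤ _ 4Kt≤n ⟩
      n + 4 * K * m                ∎)

0<factorʳ : ∀ m n → 0 < m * n → 0 < n
0<factorʳ m zero    lt = contradiction lt (<⇒≱ (s≤s (≤-reflexive (*-zeroʳ m))))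
0<factorʳ m (suc n) lt = s≤s z≤n

-- Induction on the number of coordinates: `dense-link` fixes a `t`-set for the first one, and the
-- tuples compatible with all of its elements form a dense relation on the rest, with a worse
-- constant that does not depend on `n`.
dense⇒box : ∀ k t K → ∃ λ n₀ → ∀ n → n₀ ≤ n → (R : Vec (Fin n) k → Bool) →
  n ^ k ≤ K * ∑ (tuples (allFin n) k) (ind ∘ R) → Box n k t R
dense⇒box zero t K = 0 , λ n _ R dense →
  (λ ()) , (λ ()) , λ _ → 
  0<ind (R []) (≤-trans (0<factorʳ K _ dense) (≤-reflexive (+-identityʳ _)))
dense⇒box (suc k) t K with dense⇒box k t (2 * K * (4 * K) ^ t)
... | n₀ , ih = suc (n₀ ⊔ 4 * K * t) , step
  where
  step : ∀ n → suc (n₀ ⊔ 4 * K * t) ≤ n → (R : Vec (Fin n) (suc k) → Bool) →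
    n ^ suc k ≤ K * ∑ (tuples (allFin n) (suc k)) (ind ∘ R) → Box n (suc k) t R
  step n@(suc _) large R dense
    with dense-link n k t K (s≤s z≤n) (≤-trans (m≤n⊔m n₀ _) (≤-trans (n≤1+n _) large)) R dense
  ... | xs , dense' with ih n (≤-trans (m≤m⊔n n₀ _) (≤-trans (n≤1+n _) large)) _ dense'
  ...   | X , X-inj , X-box = X⁺ , X⁺-inj , λ f →
    every-lookup _ xs (proj₂ (∧-true {distinct xs} (X-box (f ∘ Fin.suc)))) (f Fin.zero)
    where
    X⁺ : Fin (suc k) → Fin t → Fin n
    X⁺ Fin.zero    = lookup xs
    X⁺ (Fin.suc i) = X i
    -- Distinctness of `xs` is read off from the density of the link and not from the box, since for
    -- `t` zero there may be no choice function `f` to evaluate the box at.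
    link≢0 : ∑ (tuples (allFin n) k) (λ _ → 0) < ∑[ y ∈ tuples (allFin n) k ] ind (distinct xs ∧ every (λ x → R (x ∷ y)) xs)
    link≢0 = ≤-trans (≤-reflexive (cong suc (trans (∑-tuples-const n k 0) (*-zeroʳ (n ^ k)))))
      (0<factorʳ (2 * K * (4 * K) ^ t) _ (≤-trans (m^n>0 n k) dense'))
    xs-distinct : distinct xs ≡ true
    xs-distinct = proj₁ (∧-true (0<ind _ (proj₂ (∑-pigeonhole-< (tuples (allFin n) k) _ _ link≢0))))
    X⁺-inj : ∀ i → Injective _≡_ _≡_ (X⁺ i)
    X⁺-inj Fin.zero    = distinct⇒injective xs xs-distinct
    X⁺-inj (Fin.suc i) = X-inj i

-- Sampling

module Sampling (n : ℕ) where
  V : List (Fin n)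
  V = allFin n

  coordSum : (Fin n → ℕ) → Vec (Fin n) k → ℕ
  coordSum {k} g s = sumFin k (g ∘ lookup s)

  pairSum : (Fin n → Fin n → ℕ) → Vec (Fin n) k → ℕ
  pairSum {k} f s = sumFin k λ i → sumFin k λ j → f (lookup s i) (lookup s j)

  -- Each coordinate of a uniform tuple is uniform. The factor `n` on the left avoids the exponent k
  -- - 1.
  ∑-coordSum : ∀ k g → n * ∑ (tuples V k) (coordSum g) ≡ k * n ^ k * ∑ V g
  ∑-coordSum zero    g = *-zeroʳ n
  ∑-coordSum (suc k) g = begin
    n * ∑ (tuples V (suc k)) (coordSum g)
      ≡⟨ cong (n *_) (∑-tuples V k (coordSum g)) ⟩
    n * ∑ V (λ x → ∑ (tuples V k) (λ s → g x + coordSum g s))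
      ≡⟨ cong (n *_) (trans (∑-cong V λ x → trans (∑-+ (tuples V k) _ _)
           (cong (_+ ∑ (tuples V k) (coordSum g)) (∑-tuples-const n k (g x)))) (∑-+ V _ _)) ⟩
    n * (∑ V (λ x → n ^ k * g x) + ∑ V (λ x → ∑ (tuples V k) (coordSum g)))
      ≡⟨ cong (n *_) (cong₂ _+_ (∑-*ˡ V (n ^ k) g) (∑-allFin-const n _)) ⟩
    n * (n ^ k * ∑ V g + n * ∑ (tuples V k) (coordSum g))
      ≡⟨ cong (λ x → n * (n ^ k * ∑ V g + x)) (∑-coordSum k g) ⟩
    n * (n ^ k * ∑ V g + k * n ^ k * ∑ V g)
      ≡⟨ eq n (n ^ k) k (∑ V g) ⟩
    suc k * n ^ suc k * ∑ V g ∎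
    where
    open ≡-Reasoning
    eq : ∀ n N k g → n * (N * g + k * N * g) ≡ (1 + k) * (n * N) * g
    eq = solve-∀

  sumFin-+ : ∀ k f g → sumFin k (λ i → f i + g i) ≡ sumFin k f + sumFin k g
  sumFin-+ k f g = trans (sym (∑-allFin k _)) (trans (∑-+ (allFin k) f g) (cong₂ _+_ (∑-allFin k f) (∑-allFin k g)))

  pairSum-∷ : ∀ f x (s : Vec (Fin n) k) →
    pairSum f (x ∷ s) ≡ f x x + coordSum (f x) s + (coordSum (λ y → f y x) s + pairSum f s)
  pairSum-∷ {k} f x s = cong (f x x + coordSum (f x) s +_) (sumFin-+ k _ _)

  -- Two different coordinates of a uniform tuple are independent and uniform, so each of the k(k -
  -- 1) off-diagonal pairs averages to the mean of `f`; the `k` diagonal pairs are bounded by `d`.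
  ∑-pairSum : ∀ k f d → (∀ x → f x x ≤ d) →
    n * n * ∑ (tuples V k) (pairSum f) ≤ (k * d * (n * n) + k * k * ∑ V (λ x → ∑ V (f x))) * n ^ k
  ∑-pairSum zero    f d diag = ≤-reflexive (*-zeroʳ (n * n))
  ∑-pairSum (suc k) f d diag = begin
    n * n * ∑ (tuples V (suc k)) (pairSum f)
      ≡⟨ cong (n * n *_) (trans (∑-tuples V k _) (trans (∑-cong V λ x → trans (∑-cong T (pairSum-∷ f x))
           (trans (∑-+ T _ _) (cong₂ _+_ (∑-+ T _ _) (∑-+ T _ _)))) (trans (∑-+ V _ _) (cong₂ _+_ (∑-+ V _ _) (∑-+ V _ _))))) ⟩
    n * n * (∑ V (λ x → ∑ T (λ _ → f x x)) + ∑ V (λ x → ∑ T (coordSum (f x)))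
              + (∑ V (λ x → ∑ T (coordSum (λ y → f y x))) + ∑ V (λ _ → ∑ T (pairSum f))))
      ≤⟨ *-monoʳ-≤ (n * n) (+-mono-≤ (+-monoˡ-≤ _ diagonal) (+-monoʳ-≤ _ (≤-reflexive (∑-allFin-const n _)))) ⟩
    n * n * (n * (N * d) + ∑ V (λ x → ∑ T (coordSum (f x)))
              + (∑ V (λ x → ∑ T (coordSum (λ y → f y x))) + n * ∑ T (pairSum f)))
      ≡⟨ eq₁ n N d _ _ (∑ T (pairSum f)) ⟩
    n * n * n * N * d + n * (n * ∑ V (λ x → ∑ T (coordSum (f x))))
      + (n * (n * ∑ V (λ x → ∑ T (coordSum (λ y → f y x)))) + n * (n * n * ∑ T (pairSum f)))
      ≤⟨ +-mono-≤ (≤-reflexive (cong (λ x → n * n * n * N * d + n * x) (cross f)))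
           (+-mono-≤ (≤-reflexive (cong (n *_) (trans (cross λ x y → f y x) (cong (k * N *_) (∑-swap V V _)))))
             (*-monoʳ-≤ n (∑-pairSum k f d diag))) ⟩
    n * n * n * N * d + n * (k * N * C) + (n * (k * N * C) + n * ((k * d * (n * n) + k * k * C) * N))
      -- This slack rounds the count of off-diagonal pairs up to the square of the number of
      -- coordinates.
      ≤⟨ m≤m+n _ (C * n * N) ⟩
    n * n * n * N * d + n * (k * N * C) + (n * (k * N * C) + n * ((k * d * (n * n) + k * k * C) * N)) + C * n * N
      ≡⟨ eq₂ n N d k C ⟩
    (suc k * d * (n * n) + suc k * suc k * C) * n ^ suc k ∎
    where
    open ≤-Reasoning
    T : List (Vec (Fin n) k)
    T = tuples V k
    N C : ℕ
    N = n ^ k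
    C = ∑ V (λ x → ∑ V (f x))
    diagonal : ∑ V (λ x → ∑ T (λ _ → f x x)) ≤ n * (N * d)
    diagonal = ≤-trans (∑-mono V λ x → ≤-trans (≤-reflexive (∑-tuples-const n k (f x x))) (*-monoʳ-≤ N (diag x)))
      (≤-reflexive (∑-allFin-const n _))
    cross : ∀ f → n * ∑ V (λ x → ∑ T (coordSum (f x))) ≡ k * N * ∑ V (λ x → ∑ V (f x))
    cross f = trans (sym (∑-*ˡ V n _)) (trans (∑-cong V λ x → ∑-coordSum k (f x)) (∑-*ˡ V (k * N) _))
    eq₁ : ∀ n N d x y z → n * n * (n * (N * d) + x + (y + n * z))
      ≡ n * n * n * N * d + n * (n * x) + (n * (n * y) + n * (n * n * z))
    eq₁ = solve-∀
    eq₂ : ∀ n N d k C →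
      n * n * n * N * d + n * (k * N * C) + (n * (k * N * C) + n * ((k * d * (n * n) + k * k * C) * N)) + C * n * N
      ≡ ((1 + k) * d * (n * n) + (1 + k) * (1 + k) * C) * (n * N)
    eq₂ = solve-∀

-- Transitive patterns at fixed positions of a tuple

increasing : (A → A → Bool) → Vec A k → Bool
increasing R []       = true
increasing R (x ∷ xs) = every (R x) xs ∧ increasing R xs

increasing-lookup : ∀ (R : A → A → Bool) (xs : Vec A k) → increasing R xs ≡ true →
  ∀ i j → toℕ i < toℕ j → R (lookup xs i) (lookup xs j) ≡ true
increasing-lookup R (x ∷ xs) inc Fin.zero    (Fin.suc j) _         = every-lookup (R x) xs (proj₁ (∧-true inc)) j
increasing-lookup R (x ∷ xs) inc (Fin.suc i) (Fin.suc j) (s≤s i<j) =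
  increasing-lookup R xs (proj₂ (∧-true {every (R x) xs} inc)) i j i<j

prefix : ∀ k (xs : List A) → k ≤ length xs → Vec A k
prefix zero    xs       _        = []
prefix (suc k) (x ∷ xs) (s≤s le) = x ∷ prefix k xs le

every-prefix : ∀ {P : A → Bool} k {xs} (le : k ≤ length xs) → All (λ x → P x ≡ true) xs → every P (prefix k xs le) ≡ true
every-prefix zero    le       ps       = refl
every-prefix (suc k) (s≤s le) (p ∷ ps) rewrite p = every-prefix k le ps

increasing-prefix : ∀ {R : A → A → Bool} k {xs} (le : k ≤ length xs) → AllPairs (λ x y → R x y ≡ true) xs →
  increasing R (prefix k xs le) ≡ true
increasing-prefix zero    le       ps       = refl
increasing-prefix (suc k) (s≤s le) (p ∷ ps) rewrite every-prefix k le p = increasing-prefix k le ps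

pullback : (Fin n → Fin n → Bool) → Vec (Fin n) k → Fin k → Fin k → Bool
pullback adj s i j = adj (lookup s i) (lookup s j)

module Patterns (n : ℕ) (adj : Fin n → Fin n → Bool) (irr : ∀ v → adj v v ≡ false) (r K : ℕ) where
  open Sampling n

  C M : ℕ
  C = totalCost adj
  -- The diagonal adds up to `3 * r * M` to the mean of `r * pairSum c`, while the density gain 1/K
  -- takes off M²/K = (3r + 1)M. With this `M` the mean is at most 3M² - M.
  M = K * (3 * r + 1)

  T : List (Vec (Fin n) M)
  T = tuples V M

  c : Fin n → Fin n → ℕ
  c v u = cost (adj u v) (adj v u)

  -- The threshold is the one at which `transitive-chain` forces more than `r` vertices.
  good : Vec (Fin n) M → Bool
  good s = ⌊ r * pairSum c s <? 3 * (M * M) ⌋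

  -- Markov's inequality: a bad tuple has `r * pairSum c s` at least 3M², the mean is at most 3M² -
  -- M, so the good share is at least M/(3M²) = 1/(3M).
  many-good : 1 ≤ n → 1 ≤ K → K * (r * C) + n * n ≤ 3 * K * (n * n) → n ^ M ≤ 3 * M * ∑ T (ind ∘ good)
  many-good 1≤n 1≤K sparse = *-cancelˡ-≤ K {{>-nonZero 1≤K}} (*-cancelˡ-≤ (M * (n * n)) {{>-nonZero 0<Mnn}}
    (+-cancelˡ-≤ (K * (3 * r) * (M * (N * (n * n)))) _ _ (+-cancelˡ-≤ (M * M * N * (K * (r * C))) _ _ (begin
      M * M * N * (K * (r * C)) + (K * (3 * r) * (M * (N * (n * n))) + M * (n * n) * (K * N))
        ≡⟨ eq₁ K r N (n * n) C ⟩
      M * M * N * (K * (r * C) + n * n)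
        ≤⟨ *-monoʳ-≤ (M * M * N) sparse ⟩
      M * M * N * (3 * K * (n * n))
        ≡⟨ eq₂ K N (n * n) M ⟩
      K * (n * n) * (N * (3 * (M * M)))
        ≤⟨ *-monoʳ-≤ (K * (n * n)) Markov ⟩
      K * (n * n) * (r * Q + 3 * (M * M) * g)
        ≡⟨ eq₃ K r Q (n * n) M g ⟩
      K * r * (n * n * Q) + K * (n * n) * (3 * (M * M) * g)
        ≤⟨ +-monoˡ-≤ _ (*-monoʳ-≤ (K * r) (∑-pairSum M c 3 diag)) ⟩
      K * r * ((M * 3 * (n * n) + M * M * C) * N) + K * (n * n) * (3 * (M * M) * g)
        ≡⟨ eq₄ K r N (n * n) M C g ⟩
      M * M * N * (K * (r * C)) + (K * (3 * r) * (M * (N * (n * n))) + M * (n * n) * (K * (3 * M * g))) ∎))))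
    where
    open ≤-Reasoning
    N Q g : ℕ
    N = n ^ M
    Q = ∑ T (pairSum c)
    g = ∑ T (ind ∘ good)
    0<Mnn : 0 < M * (n * n)
    0<Mnn = *-mono-≤ (*-mono-≤ 1≤K (m≤n+m 1 (3 * r))) (*-mono-≤ 1≤n 1≤n)
    diag : ∀ x → c x x ≤ 3
    diag x rewrite irr x = ≤-refl
    Markov : N * (3 * (M * M)) ≤ r * Q + 3 * (M * M) * g
    Markov = begin
      N * (3 * (M * M))                                        ≡⟨ ∑-tuples-const n M _ ⟨
      ∑ T (λ _ → 3 * (M * M))                                  ≤⟨ ∑-mono T bound ⟩
      ∑ T (λ s → r * pairSum c s + 3 * (M * M) * ind (good s)) ≡⟨ ∑-+ T _ _ ⟩
      ∑ T (λ s → r * pairSum c s) + ∑ T (λ s → 3 * (M * M) * ind (good s))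
        ≡⟨ cong₂ _+_ (∑-*ˡ T r _) (∑-*ˡ T (3 * (M * M)) _) ⟩
      r * Q + 3 * (M * M) * g ∎
      where
      bound : ∀ s → 3 * (M * M) ≤ r * pairSum c s + 3 * (M * M) * ind (good s)
      bound s with r * pairSum c s <? 3 * (M * M)
      ... | yes _  = ≤-trans (≤-reflexive (sym (*-identityʳ _))) (m≤n+m _ _)
      ... | no  ≮ = ≤-trans (≮⇒≥ ≮) (m≤m+n _ _)
    eq₁ : ∀ K r N nn C → let M = K * (3 * r + 1) in
      M * M * N * (K * (r * C)) + (K * (3 * r) * (M * (N * nn)) + M * nn * (K * N))
        ≡ M * M * N * (K * (r * C) + nn)
    eq₁ = solve-∀
    eq₂ : ∀ K N nn M → M * M * N * (3 * K * nn) ≡ K * nn * (N * (3 * (M * M)))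
    eq₂ = solve-∀
    eq₃ : ∀ K r Q nn M g → K * nn * (r * Q + 3 * (M * M) * g) ≡ K * r * (nn * Q) + K * nn * (3 * (M * M) * g)
    eq₃ = solve-∀
    eq₄ : ∀ K r N nn M C g → K * r * ((M * 3 * nn + M * M * C) * N) + K * nn * (3 * (M * M) * g)
      ≡ M * M * N * (K * (r * C)) + (K * (3 * r) * (M * (N * nn)) + M * nn * (K * (3 * M * g)))
    eq₄ = solve-∀

  carries : Vec (Fin M) (suc r) → Vec (Fin n) M → Bool
  carries π s = increasing (pullback adj s) π

  totalCost-pullback : ∀ (s : Vec (Fin n) k) → totalCost (pullback adj s) ≡ pairSum c s
  totalCost-pullback {k} s = trans (∑-allFin k _) (sumFin-cong k λ i → ∑-allFin k _)

  good⇒carries : ∀ s → good s ≡ true → ∃ λ π → carries π s ≡ true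
  good⇒carries s gs with r * pairSum c s <? 3 * (M * M) | transitive-chain (pullback adj s) (λ i → irr (lookup s i))
  ... | yes lt | cs , chain , le = prefix (suc r) cs r<len , increasing-prefix (suc r) r<len chain
    where
    r<len : r < length cs
    r<len with length cs ≤? r
    ... | no ≰   = ≰⇒> ≰
    ... | yes ≤r = contradiction lt (≤⇒≯ (≤-trans le
      (≤-trans (≤-reflexive (cong (length cs *_) (totalCost-pullback s))) (*-monoˡ-≤ (pairSum c s) ≤r))))

  -- Every good tuple carries one of the `M ^ suc r` position vectors, so some vector serves its
  -- average share of the good tuples.
  popular-pattern : 1 ≤ n → 1 ≤ K → K * (r * C) + n * n ≤ 3 * K * (n * n) →
    ∃ λ π → n ^ M ≤ M ^ suc r * (3 * M) * ∑ T (ind ∘ carries π)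
  popular-pattern 1≤n 1≤K sparse = ∑-pigeonhole-≤ Π _ _ nonempty (begin
    ∑ Π (λ _ → n ^ M)                                         ≡⟨ ∑-tuples-const M (suc r) _ ⟩
    M ^ suc r * n ^ M                                         ≤⟨ *-monoʳ-≤ (M ^ suc r) (many-good 1≤n 1≤K sparse) ⟩
    M ^ suc r * (3 * M * ∑ T (ind ∘ good))                    ≤⟨ *-monoʳ-≤ (M ^ suc r) (*-monoʳ-≤ (3 * M) (∑-mono T good≤)) ⟩
    M ^ suc r * (3 * M * ∑ T (λ s → ∑ Π (λ π → ind (carries π s)))) ≡⟨ *-assoc (M ^ suc r) (3 * M) _ ⟨
    M ^ suc r * (3 * M) * ∑ T (λ s → ∑ Π (λ π → ind (carries π s))) ≡⟨ cong (M ^ suc r * (3 * M) *_) (∑-swap T Π _) ⟩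
    M ^ suc r * (3 * M) * ∑ Π (λ π → ∑ T (ind ∘ carries π))   ≡⟨ ∑-*ˡ Π (M ^ suc r * (3 * M)) _ ⟨
    ∑ Π (λ π → M ^ suc r * (3 * M) * ∑ T (ind ∘ carries π))   ∎)
    where
    open ≤-Reasoning
    Π : List (Vec (Fin M) (suc r))
    Π = tuples (allFin M) (suc r)
    nonempty : 0 < length Π
    nonempty = ≤-trans (m^n>0 M {{>-nonZero (*-mono-≤ 1≤K (m≤n+m 1 (3 * r)))}} (suc r)) (≤-reflexive (sym (length-tuples M (suc r))))
    good≤ : ∀ s → ind (good s) ≤ ∑ Π (λ π → ind (carries π s))
    good≤ s = go (good s) refl
      where
      go : ∀ b → good s ≡ b → ind b ≤ ∑ Π (λ π → ind (carries π s))
      go false _  = z≤n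
      go true  gs with good⇒carries s gs
      ... | π , eq = ≤-trans (≤-reflexive (cong ind (sym eq))) (term≤∑-tuples π (λ π → ind (carries π s)))

-- From a box to the blow-up

box⇒blowup : ∀ {n M r t} (G : Digraph n) (π : Vec (Fin M) (suc r)) →
  Box n M t (λ s → increasing (pullback (adj G) s) π) → ContainsBlowup G r t
box⇒blowup {n} {M} {r} {t} G π (X , X-inj , X-box) = φ , φ-inj , φ-arc
  where
  φ : Fin (suc r) × Fin t → Fin n
  φ (i , x) = X (lookup π i) x

  arc : ∀ (f : Fin M → Fin t) i j → toℕ i < toℕ j → adj G (φ (i , f (lookup π i))) (φ (j , f (lookup π j))) ≡ true
  arc f i j i<j = subst₂ (λ u v → adj G u v ≡ true) (lookup∘tabulate _ (lookup π i)) (lookup∘tabulate _ (lookup π j))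
    (increasing-lookup _ π (X-box f) i j i<j)

  loop-free : ∀ v → adj G v v ≢ true
  loop-free v eq with adj G v v | irrefl G v
  loop-free v () | false | refl

  -- If two entries of `π` agreed, a constant choice function would put a loop at a vertex of `G`.
  -- The element of `Fin t` supplies that constant.
  π-inj : ∀ i j → toℕ i < toℕ j → Fin t → lookup π i ≢ lookup π j
  π-inj i j i<j x eq = loop-free (φ (i , x))
    (trans (cong (λ a → adj G (φ (i , x)) (X a x)) eq) (arc (λ _ → x) i j i<j))

  φ-arc : ∀ p q → toℕ (proj₁ p) < toℕ (proj₁ q) → adj G (φ p) (φ q) ≡ true
  φ-arc (i , x) (j , y) i<j = subst₂ (λ a b → adj G (φ (i , a)) (φ (j , b)) ≡ true) fi fj (arc f i j i<j)
    where
    f : Fin M → Fin t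
    -- Only the choices at positions `lookup π i` and `lookup π j` matter. They can be prescribed
    -- independently because `π-inj` separates the positions.
    f a = if ⌊ a ≟ lookup π i ⌋ then x else y
    fi : f (lookup π i) ≡ x
    fi with lookup π i ≟ lookup π i
    ... | yes _  = refl
    ... | no neq = contradiction refl neq
    fj : f (lookup π j) ≡ y
    fj with lookup π j ≟ lookup π i
    ... | yes eq = contradiction (sym eq) (π-inj i j i<j x)
    ... | no _   = refl

  φ-inj : Injective _≡_ _≡_ φ
  -- Disjointness of different classes is not part of `Box`: a common vertex of two classes would
  -- receive a loop through `φ-arc`.
  φ-inj {i , x} {j , y} eq with <-cmp (toℕ i) (toℕ j)
  ... | tri< i<j _ _ = contradiction (trans (cong (adj G (φ (i , x))) eq) (φ-arc (i , x) (j , y) i<j)) (loop-free _)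
  ... | tri> _ _ j<i = contradiction (trans (cong (adj G (φ (j , y))) (sym eq)) (φ-arc (j , y) (i , x) j<i)) (loop-free _)
  ... | tri≈ _ i≡j _ with toℕ-injective i≡j
  ...   | refl = cong (i ,_) (X-inj (lookup π i) eq)

-- Edge counts

<ᵇ-compare : ∀ m n → m ≡ n ⊎ ind (m <ᵇ n) + ind (n <ᵇ m) ≡ 1
<ᵇ-compare zero    zero    = inj₁ refl
<ᵇ-compare zero    (suc n) = inj₂ refl
<ᵇ-compare (suc m) zero    = inj₂ refl
<ᵇ-compare (suc m) (suc n) with <ᵇ-compare m n
... | inj₁ m≡n = inj₁ (cong suc m≡n)
... | inj₂ eq  = inj₂ eq

ind-∧ : ∀ a b → ind (a ∧ b) ≡ ind a * ind b
ind-∧ true  b = sym (+-identityʳ _)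
ind-∧ false b = refl

ordered-pairs : ∀ n (P : Fin n → Fin n → Bool) → (∀ u v → P u v ≡ P v u) → (∀ v → P v v ≡ false) →
  (∑[ u ∈ allFin n ] ∑[ v ∈ allFin n ] ind (P u v)) ≡ 2 * countPairs n P
ordered-pairs n P P-sym P-irr = begin
  ∑ V (λ u → ∑ V (λ v → ind (P u v)))
    ≡⟨ ∑-cong V (λ u → trans (∑-cong V (split u)) (∑-+ V _ _)) ⟩
  ∑ V (λ u → ∑ V (λ v → up u v) + ∑ V (λ v → up v u))
    ≡⟨ ∑-+ V _ _ ⟩
  ∑ V (λ u → ∑ V (up u)) + ∑ V (λ u → ∑ V (λ v → up v u))
    ≡⟨ cong₂ _+_ refl (∑-swap V V (λ u v → up v u)) ⟩
  ∑ V (λ u → ∑ V (up u)) + ∑ V (λ u → ∑ V (up u))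
    ≡⟨ cong (λ x → x + x) (trans (∑-allFin n _) (sumFin-cong n λ u → ∑-allFin n _)) ⟩
  countPairs n P + countPairs n P
    ≡⟨ cong (countPairs n P +_) (+-identityʳ _) ⟨
  2 * countPairs n P ∎
  where
  open ≡-Reasoning
  V = allFin n
  up : Fin n → Fin n → ℕ
  up u v = ind ((toℕ u <ᵇ toℕ v) ∧ P u v)
  split : ∀ u v → ind (P u v) ≡ up u v + up v u
  split u v rewrite ind-∧ (toℕ u <ᵇ toℕ v) (P u v) | ind-∧ (toℕ v <ᵇ toℕ u) (P v u) | P-sym v u
    with <ᵇ-compare (toℕ u) (toℕ v)
  ... | inj₂ eq = trans (sym (+-identityʳ _)) (trans (cong (_* ind (P u v)) (sym eq)) (*-distribʳ-+ (ind (P u v)) (ind (toℕ u <ᵇ toℕ v)) _))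
  ... | inj₁ u≡v with toℕ-injective u≡v
  ...   | refl rewrite P-irr u = sym (cong₂ _+_ (*-zeroʳ (ind (toℕ u <ᵇ toℕ u))) (*-zeroʳ (ind (toℕ u <ᵇ toℕ u))))

∑∑-const : ∀ n c → ∑ (allFin n) (λ _ → ∑ (allFin n) (λ _ → c)) ≡ n * n * c
∑∑-const n c = trans (∑-allFin-const n _) (trans (cong (n *_) (∑-allFin-const n c)) (sym (*-assoc n n c)))

-- On each of the n² ordered pairs, diagonal included, cost and weight add up to 3, and each
-- unordered edge is met twice.
totalCost-f : ∀ {n} (G : Digraph n) → totalCost (adj G) + 2 * (3 * f₂ G + 2 * f₁ G) ≡ 3 * (n * n)
totalCost-f {n} G = begin
  totalCost (adj G) + 2 * (3 * f₂ G + 2 * f₁ G)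
    ≡⟨ eq (totalCost (adj G)) (f₂ G) (f₁ G) ⟩
  totalCost (adj G) + 3 * (2 * f₂ G) + 2 * (2 * f₁ G)
    ≡⟨ cong₂ (λ x y → totalCost (adj G) + 3 * x + 2 * y)
         (ordered-pairs n double (λ u v → ∧-comm (adj G u v) (adj G v u)) double-irr)
         (ordered-pairs n single (λ u v → xor-comm (adj G u v) (adj G v u)) single-irr) ⟨
  totalCost (adj G) + 3 * ∑∑ (λ u v → ind (double u v)) + 2 * ∑∑ (λ u v → ind (single u v))
    ≡⟨ cong₂ _+_ (cong (totalCost (adj G) +_) (∑∑-*ˡ 3 _)) (∑∑-*ˡ 2 _) ⟨
  totalCost (adj G) + ∑∑ (λ u v → 3 * ind (double u v)) + ∑∑ (λ u v → 2 * ind (single u v))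
    ≡⟨ trans (∑∑-+ _ _) (cong (_+ ∑∑ (λ u v → 2 * ind (single u v))) (∑∑-+ _ _)) ⟨
  ∑∑ (λ v u → cost (adj G u v) (adj G v u) + 3 * ind (double v u) + 2 * ind (single v u))
    ≡⟨ ∑-cong V (λ v → ∑-cong V (λ u → total (adj G u v) (adj G v u))) ⟩
  ∑∑ (λ _ _ → 3)
    ≡⟨ trans (∑∑-const n 3) (*-comm (n * n) 3) ⟩
  3 * (n * n) ∎
  where
  open ≡-Reasoning
  V = allFin n
  ∑∑ : (Fin n → Fin n → ℕ) → ℕ
  ∑∑ f = ∑ V (λ u → ∑ V (f u))
  ∑∑-+ : ∀ f g → ∑∑ (λ u v → f u v + g u v) ≡ ∑∑ f + ∑∑ g
  ∑∑-+ f g = trans (∑-cong V λ u → ∑-+ V (f u) (g u)) (∑-+ V _ _)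
  ∑∑-*ˡ : ∀ c f → ∑∑ (λ u v → c * f u v) ≡ c * ∑∑ f
  ∑∑-*ˡ c f = trans (∑-cong V λ u → ∑-*ˡ V c (f u)) (∑-*ˡ V c _)
  double single : Fin n → Fin n → Bool
  double u v = adj G u v ∧ adj G v u
  single u v = xor (adj G u v) (adj G v u)
  double-irr : ∀ v → double v v ≡ false
  double-irr v rewrite irrefl G v = refl
  single-irr : ∀ v → single v v ≡ false
  single-irr v rewrite irrefl G v = refl
  xor-comm : ∀ a b → xor a b ≡ xor b a
  xor-comm true  true  = refl
  xor-comm true  false = refl
  xor-comm false true  = refl
  xor-comm false false = refl
  total : ∀ a b → cost a b + 3 * ind (b ∧ a) + 2 * ind (xor b a) ≡ 3
  total true  true  = refl
  total true  false = refl
  total false true  = refl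
  total false false = refl
  eq : ∀ c x y → c + 2 * (3 * x + 2 * y) ≡ c + 3 * (2 * x) + 2 * (2 * y)
  eq = solve-∀

sumFin-last : ∀ n (g : ℕ → ℕ) → sumFin (suc n) (g ∘ toℕ) ≡ sumFin n (g ∘ toℕ) + g n
sumFin-last zero    g = +-identityʳ (g 0)
sumFin-last (suc n) g = trans (cong (g 0 +_) (sumFin-last n (g ∘ suc))) (sym (+-assoc (g 0) _ _))

-- The offset `c` on the left makes the induction close: when `n` has residue `c`, the bound for `n`
-- reads r·s < r(n/r + 1), and dividing by `r` gives room for one more element.
residue-count : ∀ r .{{_ : NonZero r}} c → c < r → ∀ n → r * sumFin n (λ v → ind (c ≡ᵇ toℕ v % r)) + c < n + r
residue-count r c c<r zero = ≤-trans (≤-reflexive (cong (λ x → suc (x + c)) (*-zeroʳ r))) c<r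
residue-count r c c<r (suc n) rewrite sumFin-last n (λ v → ind (c ≡ᵇ v % r)) = go (c ≡ᵇ n % r) refl
  where
  open ≤-Reasoning
  s : ℕ
  s = sumFin n (λ v → ind (c ≡ᵇ toℕ v % r))
  ih : r * s + c < n + r
  ih = residue-count r c c<r n
  go : ∀ b → (c ≡ᵇ n % r) ≡ b → r * (s + ind b) + c < suc n + r
  go false _  = ≤-trans (≤-reflexive (cong (λ x → suc (r * x + c)) (+-identityʳ s))) (≤-trans ih (n≤1+n _))
  go true  eq = s≤s (begin
    r * (s + 1) + c           ≤⟨ +-monoˡ-≤ c (*-monoʳ-≤ r (≤-trans (≤-reflexive (+-comm s 1)) s<q+1)) ⟩
    r * suc (n / r) + c       ≡⟨ eq₁ r (n / r) c ⟩
    c + n / r * r + r         ≡⟨ cong (_+ r) n≡ ⟨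
    n + r                     ∎)
    where
    n≡ : n ≡ c + n / r * r
    n≡ = trans (m≡m%n+[m/n]*n n r) (cong (_+ n / r * r) (sym (≡ᵇ⇒≡ c (n % r) (subst IsTrue (sym eq) tt))))
    eq₁ : ∀ r q c → r * (1 + q) + c ≡ c + q * r + r
    eq₁ = solve-∀
    s<q+1 : s < suc (n / r)
    s<q+1 = *-cancelˡ-< r _ _ (+-cancelʳ-< c _ _ (begin-strict
      r * s + c               <⟨ ih ⟩
      n + r                   ≡⟨ cong (_+ r) n≡ ⟩
      c + n / r * r + r       ≡⟨ eq₁ r (n / r) c ⟨
      r * suc (n / r) + c     ∎))

-- Among all n² ordered pairs, those inside a part number at most n(n + r)/r, since every residue
-- class has at most (n + r)/r elements.
turan-lower : ∀ r .{{_ : NonZero r}} n → r * (n * n) ≤ 2 * r * turan r n + n * (n + r)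
turan-lower r n = begin
  r * (n * n)
    ≡⟨ cong (r *_) (trans (sym (*-identityʳ (n * n))) (sym (∑∑-const n 1))) ⟩
  r * ∑ V (λ u → ∑ V (λ v → 1))
    ≡⟨ cong (r *_) (∑-cong V λ u → trans (∑-cong V λ v → sym (trans (+-comm (ind (not (same u v))) _) (ind+ind-not (same u v)))) (∑-+ V _ _)) ⟩
  r * ∑ V (λ u → ∑ V (λ v → ind (not (same u v))) + ∑ V (λ v → ind (same u v)))
    ≡⟨ cong (r *_) (∑-+ V _ _) ⟩
  r * (∑ V (λ u → ∑ V (λ v → ind (not (same u v)))) + ∑ V (λ u → ∑ V (λ v → ind (same u v))))
    ≡⟨ cong (λ x → r * (x + ∑ V (λ u → ∑ V (λ v → ind (same u v)))))
         (ordered-pairs n (λ u v → not (same u v)) (λ u v → cong not (≡ᵇ-comm (toℕ u % r) _)) (λ v → cong not (≡ᵇ-refl (toℕ v % r)))) ⟩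
  r * (2 * turan r n + ∑ V (λ u → ∑ V (λ v → ind (same u v))))
    ≡⟨ trans (*-distribˡ-+ r (2 * turan r n) _) (cong₂ _+_ (eq r (turan r n)) (sym (∑-*ˡ V r _))) ⟩
  2 * r * turan r n + ∑ V (λ u → r * ∑ V (λ v → ind (same u v)))
    ≤⟨ +-monoʳ-≤ (2 * r * turan r n) (∑-mono V class-size) ⟩
  2 * r * turan r n + ∑ V (λ u → n + r)
    ≡⟨ cong (2 * r * turan r n +_) (∑-allFin-const n _) ⟩
  2 * r * turan r n + n * (n + r) ∎
  where
  open ≤-Reasoning
  V = allFin n
  same : Fin n → Fin n → Bool
  same u v = (toℕ u % r) ≡ᵇ (toℕ v % r)
  class-size : ∀ u → r * ∑ V (λ v → ind (same u v)) ≤ n + r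
  class-size u = ≤-trans (≤-reflexive (cong (r *_) (∑-allFin n _)))
    (≤-trans (m≤m+n _ _) (<⇒≤ (residue-count r (toℕ u % r) (m%n<n (toℕ u) r) n)))
  ≡ᵇ-refl : ∀ m → (m ≡ᵇ m) ≡ true
  ≡ᵇ-refl zero    = refl
  ≡ᵇ-refl (suc m) = ≡ᵇ-refl m
  ≡ᵇ-comm : ∀ m n → (m ≡ᵇ n) ≡ (n ≡ᵇ m)
  ≡ᵇ-comm zero    zero    = refl
  ≡ᵇ-comm zero    (suc n) = refl
  ≡ᵇ-comm (suc m) zero    = refl
  ≡ᵇ-comm (suc m) (suc n) = ≡ᵇ-comm m n
  eq : ∀ r t → r * (2 * t) ≡ 2 * r * t
  eq = solve-∀

-- Multiplying the density surplus by `2 * r` yields two copies of `r * (n * n)`. One absorbs the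
-- rounding error `3 * K * r * n` of the Turán bound, by `3 * K ≤ n`; the other leaves the gain
-- `n * n`.
sparse-cost : ∀ r K n T C W → 1 ≤ r → 3 * K ≤ n → C + 2 * W ≡ 3 * (n * n) →
  r * (n * n) ≤ 2 * r * T + n * (n + r) → 3 * K * T + n * n ≤ K * W →
  K * (r * C) + n * n ≤ 3 * K * (n * n)
sparse-cost r K n T C W 1≤r 3K≤n C≡ turán dense =
  +-cancelʳ-≤ (2 * r * (3 * K * T) + r * (n * n)) _ _ (begin
    K * (r * C) + n * n + (2 * r * (3 * K * T) + r * (n * n))
      ≤⟨ +-monoˡ-≤ _ (+-monoʳ-≤ (K * (r * C)) (≤-trans (≤-reflexive (sym (*-identityˡ (n * n)))) (*-monoˡ-≤ (n * n) 1≤r))) ⟩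
    K * (r * C) + r * (n * n) + (2 * r * (3 * K * T) + r * (n * n))
      ≡⟨ eq₁ K r C (n * n) T ⟩
    K * (r * C) + 2 * r * (3 * K * T + n * n)
      ≤⟨ +-monoʳ-≤ (K * (r * C)) (*-monoʳ-≤ (2 * r) dense) ⟩
    K * (r * C) + 2 * r * (K * W)
      ≡⟨ eq₂ K r C W ⟩
    K * r * (C + 2 * W)
      ≡⟨ cong (K * r *_) C≡ ⟩
    K * r * (3 * (n * n))
      ≡⟨ eq₃ K r (n * n) ⟩
    3 * K * (r * (n * n))
      ≤⟨ *-monoʳ-≤ (3 * K) turán ⟩
    3 * K * (2 * r * T + n * (n + r))
      ≡⟨ eq₄ K r T n ⟩
    3 * K * (n * n) + (2 * r * (3 * K * T) + r * (3 * K * n))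
      ≤⟨ +-monoʳ-≤ (3 * K * (n * n)) (+-monoʳ-≤ (2 * r * (3 * K * T)) (*-monoʳ-≤ r (*-monoˡ-≤ n 3K≤n))) ⟩
    3 * K * (n * n) + (2 * r * (3 * K * T) + r * (n * n)) ∎)
  where
  open ≤-Reasoning
  eq₁ : ∀ K r C nn T → K * (r * C) + r * nn + (2 * r * (3 * K * T) + r * nn) ≡ K * (r * C) + 2 * r * (3 * K * T + nn)
  eq₁ = solve-∀
  eq₂ : ∀ K r C W → K * (r * C) + 2 * r * (K * W) ≡ K * r * (C + 2 * W)
  eq₂ = solve-∀
  eq₃ : ∀ K r nn → K * r * (3 * nn) ≡ 3 * K * (r * nn)
  eq₃ = solve-∀
  eq₄ : ∀ K r T n → 3 * K * (2 * r * T + n * (n + r)) ≡ 3 * K * (n * n) + (2 * r * (3 * K * T) + r * (3 * K * n))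
  eq₄ = solve-∀

-- With a = p/q and γ = c/d, multiply the hypothesis by 3/p. The coefficient of `y` becomes 3q/p <
-- 2, and that of `N` becomes 3cq/p, which is at least 3/2 because p/q ≤ 2 and c ≥ 1.
cleared-denominators : ∀ p q c d T N x y → 3 * q < 2 * p → p ≤ 2 * q → 1 ≤ c →
  p * T * d + c * N * q ≤ d * (p * x + q * y) → 3 * d * T + N ≤ d * (3 * x + 2 * y)
cleared-denominators p@(suc _) q c d T N x y 3q<2p p≤2q 1≤c le = *-cancelˡ-≤ p (begin
  p * (3 * d * T + N)               ≡⟨ eq₁ p d T N ⟩
  3 * (p * T * d) + p * N           ≤⟨ +-monoʳ-≤ (3 * (p * T * d)) pN≤ ⟩
  3 * (p * T * d) + 3 * (c * N * q) ≡⟨ *-distribˡ-+ 3 (p * T * d) _ ⟨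
  3 * (p * T * d + c * N * q)       ≤⟨ *-monoʳ-≤ 3 le ⟩
  3 * (d * (p * x + q * y))         ≡⟨ eq₂ d p x q y ⟩
  d * (3 * p * x + 3 * q * y)       ≤⟨ *-monoʳ-≤ d (+-monoʳ-≤ (3 * p * x) (*-monoˡ-≤ y (<⇒≤ 3q<2p))) ⟩
  d * (3 * p * x + 2 * p * y)       ≡⟨ eq₃ d p x y ⟩
  p * (d * (3 * x + 2 * y))         ∎)
  where
  open ≤-Reasoning
  eq₁ : ∀ p d T N → p * (3 * d * T + N) ≡ 3 * (p * T * d) + p * N
  eq₁ = solve-∀
  eq₂ : ∀ d p x q y → 3 * (d * (p * x + q * y)) ≡ d * (3 * p * x + 3 * q * y)
  eq₂ = solve-∀
  eq₃ : ∀ d p x y → d * (3 * p * x + 2 * p * y) ≡ p * (d * (3 * x + 2 * y))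
  eq₃ = solve-∀
  eq₄ : ∀ q N → 3 * q * (1 * N) ≡ 3 * (1 * N * q)
  eq₄ = solve-∀
  pN≤ : p * N ≤ 3 * (c * N * q)
  pN≤ = begin
    p * N           ≤⟨ *-monoˡ-≤ N (≤-trans p≤2q (*-monoˡ-≤ q {2} {3} (s≤s (s≤s z≤n)))) ⟩
    3 * q * N       ≡⟨ cong (3 * q *_) (*-identityˡ N) ⟨
    3 * q * (1 * N) ≡⟨ eq₄ q N ⟩
    3 * (1 * N * q) ≤⟨ *-monoʳ-≤ 3 (*-monoˡ-≤ q (*-monoˡ-≤ N 1≤c)) ⟩
    3 * (c * N * q) ∎

-- Reduction to a = 3 / 2

open import Data.Integer using (+_; -[1+_])

toℚᵘ-ℕ→ℚ : ∀ m → ℚ.toℚᵘ (ℕ→ℚ m) ℚᵘ.≃ ℚᵘ.mkℚᵘ (+ m) 0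
toℚᵘ-ℕ→ℚ m = ℚ.toℚᵘ-fromℚᵘ (ℚᵘ.mkℚᵘ (+ m) 0)

-- Dividing by a and using 1 / a < 2 / 3 reduces every a to the case a = 3 / 2.
reduce-to-3/2 : ∀ a γ → (+ 3) ℚ./ 2 ℚ.< a → a ℚ.≤ (+ 2) ℚ./ 1 → ℚ.0ℚ ℚ.< γ → ∃ λ K → 1 ≤ K × ∀ T N x y →
  a ℚ.* ℕ→ℚ T ℚ.+ γ ℚ.* ℕ→ℚ N ℚ.≤ a ℚ.* ℕ→ℚ x ℚ.+ ℕ→ℚ y →
  3 * K * T + N ≤ K * (3 * x + 2 * y)
reduce-to-3/2 (mkℚ -[1+ _ ] _ _) γ (ℚ.*<* ()) a≤2 0<γ
reduce-to-3/2 (mkℚ (+ _) _ _) (mkℚ -[1+ _ ] _ _) 3/2<a a≤2 (ℚ.*<* ())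
reduce-to-3/2 (mkℚ (+ _) _ _) (mkℚ (+ 0) _ _) 3/2<a a≤2 (ℚ.*<* (ℤ.+<+ ()))
reduce-to-3/2 a@(mkℚ (+ p) q-1 _) γ@(mkℚ (+ c@(suc _)) d-1 _) (ℚ.*<* 3/2<a) (ℚ.*≤* a≤2) 0<γ =
  -- The witness for `K` is the denominator of `γ`; its numerator is positive, so 1/d ≤ γ.
  d , s≤s z≤n , λ T N x y le → cleared-denominators p q c d T N x y
    (≤-trans (ℤ.drop‿+<+ (subst (+ (3 * q) ℤ.<_) (sym (ℤ.pos-* p 2)) 3/2<a)) (≤-reflexive (*-comm p 2)))
    (≤-trans (≤-reflexive (sym (*-identityʳ p))) (ℤ.drop‿+≤+ (subst (ℤ._≤ + (2 * q)) (sym (ℤ.pos-* p 1)) a≤2)))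
    (s≤s z≤n)
    (clear T N x y le)
  where
  q d : ℕ
  q = suc q-1
  d = suc d-1
  module _ (T N x y : ℕ) (le : a ℚ.* ℕ→ℚ T ℚ.+ γ ℚ.* ℕ→ℚ N ℚ.≤ a ℚ.* ℕ→ℚ x ℚ.+ ℕ→ℚ y) where
    aᵘ γᵘ lhs rhs : ℚᵘ.ℚᵘ
    aᵘ = ℚᵘ.mkℚᵘ (+ p) q-1
    γᵘ = ℚᵘ.mkℚᵘ (+ c) d-1
    lhs = aᵘ ℚᵘ.* ℚᵘ.mkℚᵘ (+ T) 0 ℚᵘ.+ γᵘ ℚᵘ.* ℚᵘ.mkℚᵘ (+ N) 0
    rhs = aᵘ ℚᵘ.* ℚᵘ.mkℚᵘ (+ x) 0 ℚᵘ.+ ℚᵘ.mkℚᵘ (+ y) 0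

    product : ∀ b m → ℚ.toℚᵘ (b ℚ.* ℕ→ℚ m) ℚᵘ.≃ ℚ.toℚᵘ b ℚᵘ.* ℚᵘ.mkℚᵘ (+ m) 0
    product b m = ℚᵘ.≃-trans (ℚ.toℚᵘ-homo-* b (ℕ→ℚ m)) (ℚᵘ.*-cong (ℚᵘ.≃-refl {ℚ.toℚᵘ b}) (toℚᵘ-ℕ→ℚ m))

    leᵘ : lhs ℚᵘ.≤ rhs
    leᵘ = ℚᵘ.≤-respˡ-≃ (ℚᵘ.≃-trans (ℚ.toℚᵘ-homo-+ (a ℚ.* ℕ→ℚ T) (γ ℚ.* ℕ→ℚ N)) (ℚᵘ.+-cong (product a T) (product γ N)))
      (ℚᵘ.≤-respʳ-≃ (ℚᵘ.≃-trans (ℚ.toℚᵘ-homo-+ (a ℚ.* ℕ→ℚ x) (ℕ→ℚ y)) (ℚᵘ.+-cong (product a x) (toℚᵘ-ℕ→ℚ y)))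
        (ℚ.toℚᵘ-mono-≤ le))

    pos-* : ∀ m n → + m ℤ.* + n ≡ + (m * n)
    pos-* m n = sym (ℤ.pos-* m n)

    clear : p * T * d + c * N * q ≤ d * (p * x + q * y)
    clear with leᵘ
    -- Unnormalised cross-multiplication keeps the denominator `q` of `a` on both sides, hence a
    -- spare factor `q` to cancel.
    ... | ℚᵘ.*≤* le' = *-cancelʳ-≤ _ _ q (subst₂ _≤_ (eqˡ p T d c N q) (eqʳ p x q y d) (ℤ.drop‿+≤+ (subst₂ ℤ._≤_ castˡ castʳ le')))
      where
      castˡ : ℚᵘ.↥ lhs ℤ.* ℚᵘ.↧ rhs ≡ + ((p * T * (d * 1) + c * N * (q * 1)) * (q * 1 * 1))
      castˡ rewrite pos-* p T | pos-* c N | pos-* (p * T) (d * 1) | pos-* (c * N) (q * 1) =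
        pos-* (p * T * (d * 1) + c * N * (q * 1)) (q * 1 * 1)
      castʳ : ℚᵘ.↥ rhs ℤ.* ℚᵘ.↧ lhs ≡ + ((p * x * 1 + y * (q * 1)) * (q * 1 * (d * 1)))
      castʳ rewrite pos-* p x | pos-* (p * x) 1 | pos-* y (q * 1) =
        pos-* (p * x * 1 + y * (q * 1)) (q * 1 * (d * 1))
      eqˡ : ∀ p T d c N q → (p * T * (d * 1) + c * N * (q * 1)) * (q * 1 * 1) ≡ (p * T * d + c * N * q) * q
      eqˡ = solve-∀
      eqʳ : ∀ p x q y d → (p * x * 1 + y * (q * 1)) * (q * 1 * (d * 1)) ≡ d * (p * x + q * y) * q
      eqʳ = solve-∀

theorem3p1 : (r t : ℕ) → .{{_ : NonZero r}} → .{{_ : NonZero t}} → (a γ : ℚ) →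
    (+ 3) ℚ./ 2 ℚ.< a → a ℚ.≤ (+ 2) ℚ./ 1 → ℚ.0ℚ ℚ.< γ →
    ∃ λ n₀ → ∀ (n : ℕ) → n₀ ≤ n → (G : Digraph n) →
    a ℚ.* ℕ→ℚ (turan r n) ℚ.+ γ ℚ.* ℕ→ℚ (n ^ 2) ℚ.≤ e a G →
    ContainsBlowup G r t
theorem3p1 r t a γ 3/2<a a≤2 0<γ = suc (n₁ + 3 * K) , found
  where
  reduction = reduce-to-3/2 a γ 3/2<a a≤2 0<γ
  K M : ℕ
  K = proj₁ reduction
  M = K * (3 * r + 1)
  -- The density constant combines the `M ^ suc r` candidate patterns with the share 1/(3M) of good
  -- tuples; it depends on `r` and `K` but not on `n`.
  boxes = dense⇒box M t (M ^ suc r * (3 * M))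
  n₁ : ℕ
  n₁ = proj₁ boxes
  found : ∀ n → suc (n₁ + 3 * K) ≤ n → (G : Digraph n) →
    a ℚ.* ℕ→ℚ (turan r n) ℚ.+ γ ℚ.* ℕ→ℚ (n ^ 2) ℚ.≤ e a G → ContainsBlowup G r t
  found n large G dense = box⇒blowup G (proj₁ pattern-π)
    (proj₂ boxes n (≤-trans (m≤m+n n₁ _) (<⇒≤ large)) _ (proj₂ pattern-π))
    where
    open Patterns n (adj G) (irrefl G) r K using (popular-pattern)
    n²≡ : n ^ 2 ≡ n * n
    n²≡ = cong (n *_) (*-identityʳ n)
    pattern-π = popular-pattern (≤-trans (s≤s z≤n) large) (proj₁ (proj₂ reduction))
      (sparse-cost r K n (turan r n) _ _ (>-nonZero⁻¹ r) (≤-trans (m≤n+m _ n₁) (<⇒≤ large)) (totalCost-f G) (turan-lower r n)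
        (subst (λ m → 3 * K * turan r n + m ≤ K * (3 * f₂ G + 2 * f₁ G)) n²≡
          (proj₂ (proj₂ reduction) (turan r n) (n ^ 2) (f₂ G) (f₁ G) dense)))
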